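{- Let $D_1$ and $D_2$ be simple digraphs on $n_1$ and $n_2$ vertices, with $D_1$ having $m_1$ arcs, and let $G_1=U(D_1)$ be the underlying graph of $D_1$, with $m_1'$ edges. Then (i) $\displaystyle f_{Q(D_1 \overrightarrow{\diamond} D_2)} (\lambda)= \big[f_{Q(D_2)}(\lambda-1)\big]^{m_1} \det\left(\lambda I_{n_1}-\big(Q(D_1)+n_2D_{\rm out}(D_1)\big)-\chi_{Q(D_2)}(\lambda-1)\,A(D_1)\right)$, (ii) $\displaystyle f_{Q(D_1 \overleftarrow{\diamond} D_2)}(\lambda)= \big[f_{Q(D_2)}(\lambda-1)\big]^{m_1} \det\left(\lambda I_{n_1}-\big(Q(D_1)+n_2D_{\rm in}(D_1)\big)-\chi_{Q(D_2)}(\lambda-1)\,A(D_1)^T\right)$, (iii) $\displaystyle f_{Q(D_1 \overleftrightarrow{\diamond} D_2)}(\lambda)= \big[f_{Q(D_2)}(\lambda-2)\big]^{m_1'}\det\left(\lambda I_{n_1}-\big(Q(D_1)+n_2D_{\rm deg}(G_1)\big)-\chi_{Q(D_2)}(\lambda-2)\,Q(G_1)\right)$.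
   Context: Digraphs are simple. $A(D)$ is the adjacency matrix, $D_{\rm out}(D)$ and $D_{\rm in}(D)$ the diagonal out-degree and in-degree matrices, $Q(D)=D_{\rm out}(D)+A(D)$. The underlying graph $U(D)$ has an edge $\{u,v\}$ whenever $uv$ or $vu$ is an arc; for a graph $G$, $D_{\rm deg}(G)$ is the diagonal degree matrix and $Q(G)=D_{\rm deg}(G)+A(G)$. $f_M(\lambda)=\det(\lambda I-M)$; for a real $n\times n$ matrix $M$ over $\mathbb{C}(\lambda)$, $\chi_M(\lambda)=\mathbf{1}_n^T(\lambda I_n-M)^{ -1}\mathbf{1}_n$ ($\mathbf{1}_n$ the all-ones vector). Forward-arc-corona $D_1 \overrightarrow{\diamond} D_2$: one copy of $D_1$ and $m_1$ disjoint copies of $D_2$, one per arc; for each arc $a_k=uv$ and each vertex $w$ of the $k$-th copy add arcs $uw$ and $wv$. Backward-arc-corona $D_1 \overleftarrow{\diamond} D_2$: same, but add arcs $vw$ and $wu$. Symmetric-arc-corona $D_1 \overleftrightarrow{\diamond} D_2$: one copy of $D_1$ and one copy of $D_2$ per edge of $U(D_1)$; for each edge $\{u,v\}$ and each vertex $w$ of the corresponding copy add arcs $uw,wu,vw,wv$. -}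

module Defs where

import Data.Bool
open import Data.Bool using (Bool; true; false; if_then_else_; _∨_)
open import Data.Nat as ℕ using (ℕ; zero; suc)
open import Data.Integer using (+_)
import Data.Fin
open import Data.Fin using (Fin; zero; suc; punchIn; splitAt; remQuot; _<_)
open import Data.Fin.Properties using () renaming (_≟_ to _≟ᶠ_)
open import Data.Sum using (_⊎_; inj₁; inj₂)
open import Data.Product using (Σ; _×_; _,_; proj₁; proj₂)
open import Data.Rational using (ℚ; 0ℚ; 1ℚ; _+_; _*_; -_; _-_; _/_; 1/_; ≢-nonZero)
open import Data.Rational.Properties using (_≟_)
open import Relation.Nullary using (yes; no; does)
open import Relation.Binary.PropositionalEquality using (_≡_; _≢_)

Mat : ℕ → Set
Mat n = Fin n → Fin n → ℚ

ℕtoℚ : ℕ → ℚ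
ℕtoℚ k = (+ k) / 1

b2q : Bool → ℚ
b2q true  = 1ℚ
b2q false = 0ℚ

sumF : ∀ {n} → (Fin n → ℚ) → ℚ
sumF {zero}  f = 0ℚ
sumF {suc n} f = f zero + sumF (λ i → f (suc i))

sgn : ℕ → ℚ
sgn zero    = 1ℚ
sgn (suc k) = - sgn k

pow : ℚ → ℕ → ℚ
pow x zero    = 1ℚ
pow x (suc k) = x * pow x k

δ : ∀ {n} → Fin n → Fin n → ℚ
δ i j = if does (i ≟ᶠ j) then 1ℚ else 0ℚ

idM : ∀ {n} → Mat n
idM = δ

_⊕_ : ∀ {n} → Mat n → Mat n → Mat n
(M ⊕ N) i j = M i j + N i j

_⊖_ : ∀ {n} → Mat n → Mat n → Mat n
(M ⊖ N) i j = M i j - N i j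

_·_ : ∀ {n} → ℚ → Mat n → Mat n
(c · M) i j = c * M i j

transpose : ∀ {n} → Mat n → Mat n
transpose M i j = M j i

diag : ∀ {n} → (Fin n → ℚ) → Mat n
diag d i j = δ i j * d i

shift : ∀ {n} → ℚ → Mat n → Mat n
shift x M = (x · idM) ⊖ M

det : ∀ {n} → Mat n → ℚ
det {zero}  M = 1ℚ
det {suc n} M =
  sumF (λ j → sgn (Data.Fin.toℕ j) * (M zero j * det (λ a b → M (suc a) (punchIn j b))))

adjugate : ∀ {n} → Mat n → Mat n
adjugate {zero}  M ()
adjugate {suc n} M i j =
  sgn (Data.Fin.toℕ i ℕ.+ Data.Fin.toℕ j) * det (λ a b → M (punchIn j a) (punchIn i b))

charPoly : ∀ {n} → Mat n → ℚ → ℚ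
charPoly M x = det (shift x M)

inv : (p : ℚ) → p ≢ 0ℚ → ℚ
inv p ne = (1/ p) {{≢-nonZero ne}}

-- chi_M(x) = 1^T (x I - M)^{-1} 1, with (x I - M)^{-1} = adj(x I - M) / det(x I - M).
-- (Only meaningful when det(x I - M) ≠ 0; the theorem assumes this. Defaults to 0 otherwise.)
chi : ∀ {n} → Mat n → ℚ → ℚ
chi M x with det (shift x M) ≟ 0ℚ
... | yes _ = 0ℚ
... | no ne = sumF (λ i → sumF (λ j → adjugate (shift x M) i j)) * inv (det (shift x M)) ne

record Digraph (n : ℕ) : Set where
  field
    adj      : Fin n → Fin n → Bool
    loopless : ∀ u → adj u u ≡ false
open Digraph public

Arc : ∀ {n} → Digraph n → Set
Arc {n} D = Σ (Fin n × Fin n) (λ p → adj D (proj₁ p) (proj₂ p) ≡ true)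

uadj : ∀ {n} → Digraph n → Fin n → Fin n → Bool
uadj D u v = adj D u v ∨ adj D v u

Edge : ∀ {n} → Digraph n → Set
Edge {n} D = Σ (Fin n × Fin n) (λ p → (proj₁ p < proj₂ p) × (uadj D (proj₁ p) (proj₂ p) ≡ true))

AM : ∀ {N} → (Fin N → Fin N → Bool) → Mat N
AM a i j = b2q (a i j)

DoutM : ∀ {N} → (Fin N → Fin N → Bool) → Mat N
DoutM a = diag (λ i → sumF (λ j → b2q (a i j)))

DinM : ∀ {N} → (Fin N → Fin N → Bool) → Mat N
DinM a = diag (λ i → sumF (λ j → b2q (a j i)))

QM : ∀ {N} → (Fin N → Fin N → Bool) → Mat N
QM a = DoutM a ⊕ AM a

A[_] Dout[_] Din[_] Q[_] : ∀ {n} → Digraph n → Mat n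
A[ D ]    = AM (adj D)
Dout[ D ] = DoutM (adj D)
Din[ D ]  = DinM (adj D)
Q[ D ]    = QM (adj D)

Ddeg[U_] AU[_] QU[_] : ∀ {n} → Digraph n → Mat n
Ddeg[U D ] = DoutM (uadj D)
AU[ D ]    = AM (uadj D)
QU[ D ]    = QM (uadj D)

-- Coronas.  Vertex set: V(D1) ⊎ (index of arc/edge × V(D2)), labelled by
-- Fin (n1 + k * n2) via splitAt / remQuot (vertex (k , w) = vertex w of the k-th copy).

label : ∀ n1 k n2 → Fin (n1 ℕ.+ k ℕ.* n2) → Fin n1 ⊎ (Fin k × Fin n2)
label n1 k n2 x with splitAt n1 x
... | inj₁ u = inj₁ u
... | inj₂ y = inj₂ (remQuot n2 y)

_==_ : ∀ {n} → Fin n → Fin n → Bool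
i == j = does (i ≟ᶠ j)

coronaAdj : ∀ {n1 n2 k} → Digraph n1 → Digraph n2 →
            (Fin k → Fin n1 → Bool) → (Fin k → Fin n1 → Bool) →
            Fin n1 ⊎ (Fin k × Fin n2) → Fin n1 ⊎ (Fin k × Fin n2) → Bool
coronaAdj D1 D2 into outof (inj₁ u) (inj₁ v) = adj D1 u v
coronaAdj D1 D2 into outof (inj₁ u) (inj₂ (k , w)) = into k u
coronaAdj D1 D2 into outof (inj₂ (k , w)) (inj₁ v) = outof k v
coronaAdj D1 D2 into outof (inj₂ (k , w)) (inj₂ (k' , w')) = (k == k') Data.Bool.∧ adj D2 w w'

tail head : ∀ {n} {D : Digraph n} → Arc D → Fin n
tail a = proj₁ (proj₁ a)
head a = proj₂ (proj₁ a)

-- Forward-arc-corona: for the k-th arc uv, arcs u → w and w → v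
fwdCorona : ∀ {n1 n2 m1} (D1 : Digraph n1) (D2 : Digraph n2) → (Fin m1 → Arc D1) →
            Fin (n1 ℕ.+ m1 ℕ.* n2) → Fin (n1 ℕ.+ m1 ℕ.* n2) → Bool
fwdCorona {n1} {n2} {m1} D1 D2 e x y =
  coronaAdj D1 D2 (λ k u → tail {D = D1} (e k) == u) (λ k v → head {D = D1} (e k) == v)
            (label n1 m1 n2 x) (label n1 m1 n2 y)

-- Backward-arc-corona: for the k-th arc uv, arcs v → w and w → u
bwdCorona : ∀ {n1 n2 m1} (D1 : Digraph n1) (D2 : Digraph n2) → (Fin m1 → Arc D1) →
            Fin (n1 ℕ.+ m1 ℕ.* n2) → Fin (n1 ℕ.+ m1 ℕ.* n2) → Bool
bwdCorona {n1} {n2} {m1} D1 D2 e x y =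
  coronaAdj D1 D2 (λ k v → head {D = D1} (e k) == v) (λ k u → tail {D = D1} (e k) == u)
            (label n1 m1 n2 x) (label n1 m1 n2 y)

-- Symmetric-arc-corona: for the k-th edge {u,v} of U(D1), arcs u → w, w → u, v → w, w → v
symCorona : ∀ {n1 n2 m1'} (D1 : Digraph n1) (D2 : Digraph n2) → (Fin m1' → Edge D1) →
            Fin (n1 ℕ.+ m1' ℕ.* n2) → Fin (n1 ℕ.+ m1' ℕ.* n2) → Bool
symCorona {n1} {n2} {m1'} D1 D2 e x y =
  coronaAdj D1 D2 ends ends (label n1 m1' n2 x) (label n1 m1' n2 y)
  where
  ends : Fin m1' → Fin n1 → Bool
  ends k z = (proj₁ (proj₁ (e k)) == z) ∨ (proj₂ (proj₁ (e k)) == z)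

-- Order the vertices of a corona as V(D₁) followed by the copies of D₂.  Then λI − Q of the
-- corona is a block matrix [[P, B], [C, I_m ⊗ K]] with K = (λ − r)I − Q(D₂), where r is the
-- number of arcs from a copy vertex back into D₁, and B, C are constant on each copy: the k-th
-- copy meets a vertex u of D₁ only through numbers β_k(u) and γ_k(u).  Since B = Y (I_m ⊗ K) for
-- Y = B (I_m ⊗ K⁻¹), the Schur complement gives det = (det K)^m · det (P − Y C), and because B
-- and C are constant on blocks, Y C = (1ᵀ K⁻¹ 1) Σ_k β_k γ_kᵀ = χ_{Q(D₂)}(λ − r) Σ_k β_k γ_kᵀ.
-- Counting arcs (or edges) identifies Σ_k β_k γ_kᵀ with A(D₁), A(D₁)ᵀ or Q(U(D₁)), and the arcs
-- from D₁ into the copies add n₂ D_out, n₂ D_in or n₂ D_deg to the diagonal of P.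

module Submission where

open import Defs
open import Algebra.Bundles using (CommutativeRing)
open import Axiom.UniquenessOfIdentityProofs using (module Decidable⇒UIP)
open import Data.Bool as Bool using (Bool; true; false; if_then_else_; _∧_; _∨_)
import Data.Bool.Properties as Bool
open import Data.Fin as Fin
  using (Fin; zero; suc; _<_; toℕ; punchIn; punchOut; _↑ˡ_; _↑ʳ_; splitAt; combine; remQuot)
open import Data.Fin.Properties
  using (punchInᵢ≢i; punchIn-punchOut; toℕ-↑ˡ; ↑ˡ-injective; ↑ʳ-injective; splitAt-↑ˡ; splitAt-↑ʳ;
         combine-remQuot; remQuot-combine; combine-injectiveˡ; combine-injectiveʳ;
         _<?_; <-cmp; <-asym; <-irrelevant; <⇒≢)
  renaming (_≟_ to _≟ᶠ_)
import Data.Integer as ℤ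
import Data.Integer.Properties as ℤP
open import Data.Nat as ℕ using (ℕ; zero; suc)
import Data.Nat.Coprimality as ℕC
import Data.Nat.Properties as ℕP
open import Data.Product using (Σ; _×_; _,_; proj₁; proj₂)
open import Data.Rational using (ℚ; mkℚ; 0ℚ; 1ℚ; _+_; _*_; -_; _-_; ≢-nonZero)
open import Data.Rational.Properties
  using (+-*-commutativeRing; _≟_; normalize-coprime; +-identityˡ; +-identityʳ; +-assoc;
         *-identityˡ; *-identityʳ; *-zeroˡ; *-zeroʳ; *-comm; *-distribˡ-+; *-inverseˡ;
         neg-distribˡ-*; neg-distrib-+)
open import Data.Rational.Solver using (module +-*-Solver)
open import Data.Sum using (inj₁; inj₂; [_,_]′)
open import Function using (_∘_; _↔_; Inverse)
open import Relation.Binary using (tri<; tri≈; tri>)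
open import Relation.Binary.PropositionalEquality
open import Relation.Nullary using (Dec; yes; no; does; contradiction)
open import Relation.Nullary.Decidable using (dec-true; dec-false; _×-dec_)

open import Algebra.Properties.Semiring.Sum (CommutativeRing.semiring +-*-commutativeRing)
  using (sum; sum-cong-≗; sum-replicate-zero; ∑-distrib-+; ∑-comm; sum-remove; *-distribˡ-sum; *-distribʳ-sum)
open +-*-Solver
open ≡-Reasoning

-- Finite sums

sumF≡sum : ∀ {n} (f : Fin n → ℚ) → sumF f ≡ sum f
sumF≡sum {zero}  f = refl
sumF≡sum {suc n} f = cong (f zero +_) (sumF≡sum (λ i → f (suc i)))

sumF-cong : ∀ {n} {f g : Fin n → ℚ} → (∀ i → f i ≡ g i) → sumF f ≡ sumF g
sumF-cong {f = f} {g} f≗g = begin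
  sumF f ≡⟨ sumF≡sum f ⟩ sum f ≡⟨ sum-cong-≗ f≗g ⟩ sum g ≡⟨ sumF≡sum g ⟨ sumF g ∎

sumF-+ : ∀ {n} (f g : Fin n → ℚ) → sumF (λ i → f i + g i) ≡ sumF f + sumF g
sumF-+ f g
  rewrite sumF≡sum (λ i → f i + g i) | sumF≡sum f | sumF≡sum g = ∑-distrib-+ f g

*-distribˡ-sumF : ∀ {n} (c : ℚ) (f : Fin n → ℚ) → c * sumF f ≡ sumF (λ i → c * f i)
*-distribˡ-sumF c f rewrite sumF≡sum f | sumF≡sum (λ i → c * f i) = *-distribˡ-sum c f

*-distribʳ-sumF : ∀ {n} (c : ℚ) (f : Fin n → ℚ) → sumF f * c ≡ sumF (λ i → f i * c)
*-distribʳ-sumF c f rewrite sumF≡sum f | sumF≡sum (λ i → f i * c) = *-distribʳ-sum c f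

sumF-comm : ∀ {m n} (f : Fin m → Fin n → ℚ) →
            sumF (λ i → sumF (f i)) ≡ sumF (λ j → sumF (λ i → f i j))
sumF-comm f = begin
  sumF (λ i → sumF (f i))            ≡⟨ sumF-cong (λ i → sumF≡sum (f i)) ⟩
  sumF (λ i → sum (f i))             ≡⟨ sumF≡sum (λ i → sum (f i)) ⟩
  sum (λ i → sum (f i))              ≡⟨ ∑-comm f ⟩
  sum (λ j → sum (λ i → f i j))      ≡⟨ sumF≡sum (λ j → sum (λ i → f i j)) ⟨
  sumF (λ j → sum (λ i → f i j))     ≡⟨ sumF-cong (λ j → sumF≡sum (λ i → f i j)) ⟨
  sumF (λ j → sumF (λ i → f i j))    ∎

sumF-remove : ∀ {n} (i : Fin (suc n)) (f : Fin (suc n) → ℚ) →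
              sumF f ≡ f i + sumF (λ k → f (punchIn i k))
sumF-remove i f rewrite sumF≡sum f | sumF≡sum (λ k → f (punchIn i k)) = sum-remove f

sumF-zero : ∀ {n} (f : Fin n → ℚ) → (∀ i → f i ≡ 0ℚ) → sumF f ≡ 0ℚ
sumF-zero {n} f f≗0 = trans (sumF-cong f≗0) (trans (sumF≡sum {n} (λ _ → 0ℚ)) (sum-replicate-zero n))

sumF-↑ : ∀ m {n} (f : Fin (m ℕ.+ n) → ℚ) →
         sumF f ≡ sumF (λ i → f (i ↑ˡ n)) + sumF (λ j → f (m ↑ʳ j))
sumF-↑ zero    f = sym (+-identityˡ (sumF f))
sumF-↑ (suc m) {n} f = begin
  f zero + sumF (λ i → f (suc i))
    ≡⟨ cong (f zero +_) (sumF-↑ m (λ i → f (suc i))) ⟩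
  f zero + (sumF (λ i → f (suc (i ↑ˡ n))) + sumF (λ j → f (suc (m ↑ʳ j))))
    ≡⟨ +-assoc (f zero) _ _ ⟨
  (f zero + sumF (λ i → f (suc (i ↑ˡ n)))) + sumF (λ j → f (suc (m ↑ʳ j))) ∎

sumF-combine : ∀ m n (f : Fin (m ℕ.* n) → ℚ) →
               sumF f ≡ sumF (λ k → sumF (λ w → f (combine {m} {n} k w)))
sumF-combine zero    n f = refl
sumF-combine (suc m) n f = trans (sumF-↑ n f) (cong (sumF (λ w → f (w ↑ˡ m ℕ.* n)) +_)
                                                    (sumF-combine m n (λ t → f (n ↑ʳ t))))

sumF-neg : ∀ {n} (f : Fin n → ℚ) → sumF (λ i → - f i) ≡ - sumF f
sumF-neg {zero}  f = refl
sumF-neg {suc n} f = trans (cong (- f zero +_) (sumF-neg (λ i → f (suc i))))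
                           (sym (neg-distrib-+ (f zero) (sumF (λ i → f (suc i)))))

*-distribˡ-sumF² : ∀ {n} (c d : ℚ) (f : Fin n → ℚ) → c * (d * sumF f) ≡ sumF (λ i → c * (d * f i))
*-distribˡ-sumF² c d f =
  trans (cong (c *_) (*-distribˡ-sumF d f)) (*-distribˡ-sumF c (λ i → d * f i))

ℕtoℚ-suc : ∀ n → ℕtoℚ (suc n) ≡ 1ℚ + ℕtoℚ n
ℕtoℚ-suc n = sym (trans (cong (1ℚ +_) (normalize-coprime (ℕC.sym (ℕC.1-coprimeTo n)))) 1+n)
  where
  1+n : 1ℚ + mkℚ (ℤ.+ n) 0 (ℕC.sym (ℕC.1-coprimeTo n)) ≡ ℕtoℚ (suc n)
  1+n rewrite ℤP.+◃n≡+n (n ℕ.* 1) | ℕP.*-identityʳ n = refl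

sumF-const : ∀ n (c : ℚ) → sumF {n} (λ _ → c) ≡ ℕtoℚ n * c
sumF-const zero    c = sym (*-zeroˡ c)
sumF-const (suc n) c = begin
  c + sumF {n} (λ _ → c)  ≡⟨ cong (c +_) (sumF-const n c) ⟩
  c + ℕtoℚ n * c          ≡⟨ solve 2 (λ c a → c :+ a :* c := (con 1ℚ :+ a) :* c) refl c (ℕtoℚ n) ⟩
  (1ℚ + ℕtoℚ n) * c       ≡⟨ cong (_* c) (ℕtoℚ-suc n) ⟨
  ℕtoℚ (suc n) * c        ∎

zeroExtendˡ : ∀ n {p} → (Fin p → ℚ) → Fin (n ℕ.+ p) → ℚ
zeroExtendˡ n y t = [ (λ _ → 0ℚ) , y ]′ (splitAt n t)

sumF-zeroExtendˡ : ∀ n {p} (y : Fin p → ℚ) (g : Fin (n ℕ.+ p) → ℚ) →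
  sumF (λ t → zeroExtendˡ n y t * g t) ≡ sumF (λ t → y t * g (n ↑ʳ t))
sumF-zeroExtendˡ n {p} y g = begin
  sumF (λ t → zeroExtendˡ n y t * g t)
    ≡⟨ sumF-↑ n (λ t → zeroExtendˡ n y t * g t) ⟩
  sumF (λ u → zeroExtendˡ n y (u ↑ˡ p) * g (u ↑ˡ p)) + sumF (λ t → zeroExtendˡ n y (n ↑ʳ t) * g (n ↑ʳ t))
    ≡⟨ cong₂ _+_ (sumF-zero _ left) (sumF-cong right) ⟩
  0ℚ + sumF (λ t → y t * g (n ↑ʳ t))
    ≡⟨ +-identityˡ _ ⟩
  sumF (λ t → y t * g (n ↑ʳ t)) ∎
  where
  left : ∀ u → zeroExtendˡ n y (u ↑ˡ p) * g (u ↑ˡ p) ≡ 0ℚ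
  left u rewrite splitAt-↑ˡ n u p = *-zeroˡ (g (u ↑ˡ p))
  right : ∀ t → zeroExtendˡ n y (n ↑ʳ t) * g (n ↑ʳ t) ≡ y t * g (n ↑ʳ t)
  right t rewrite splitAt-↑ʳ n p t = refl

-- Kronecker delta and indicators

==-sym : ∀ {n} (i j : Fin n) → (i == j) ≡ (j == i)
==-sym i j with i ≟ᶠ j | j ≟ᶠ i
... | yes _   | yes _   = refl
... | yes i≡j | no  j≢i = contradiction (sym i≡j) j≢i
... | no  i≢j | yes j≡i = contradiction (sym j≡i) i≢j
... | no  _   | no  _   = refl

δ-sym : ∀ {n} (i j : Fin n) → δ i j ≡ δ j i
δ-sym i j = cong (λ b → if b then 1ℚ else 0ℚ) (==-sym i j)

δ-refl : ∀ {n} (i : Fin n) → δ i i ≡ 1ℚ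
δ-refl i rewrite dec-true (i ≟ᶠ i) refl = refl

δ-≢ : ∀ {n} {i j : Fin n} → i ≢ j → δ i j ≡ 0ℚ
δ-≢ {i = i} {j} i≢j rewrite dec-false (i ≟ᶠ j) i≢j = refl

δ-injective : ∀ {m n} (f : Fin m → Fin n) → (∀ {x y} → f x ≡ f y → x ≡ y) → ∀ x y → δ (f x) (f y) ≡ δ x y
δ-injective f f-inj x y with x ≟ᶠ y
... | yes refl = δ-refl (f x)
... | no  x≢y  = δ-≢ (x≢y ∘ f-inj)

sumF-δ : ∀ {n} (j : Fin n) (f : Fin n → ℚ) → sumF (λ i → δ i j * f i) ≡ f j
sumF-δ {suc n} j f = begin
  sumF (λ i → δ i j * f i)
    ≡⟨ sumF-remove j (λ i → δ i j * f i) ⟩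
  δ j j * f j + sumF (λ k → δ (punchIn j k) j * f (punchIn j k))
    ≡⟨ cong₂ _+_ diagonal (sumF-zero _ offDiagonal-zero) ⟩
  f j + 0ℚ
    ≡⟨ +-identityʳ (f j) ⟩
  f j ∎
  where
  diagonal : δ j j * f j ≡ f j
  diagonal = trans (cong (_* f j) (δ-refl j)) (*-identityˡ (f j))
  offDiagonal-zero : ∀ k → δ (punchIn j k) j * f (punchIn j k) ≡ 0ℚ
  offDiagonal-zero k = trans (cong (_* f (punchIn j k)) (δ-≢ (punchInᵢ≢i j k))) (*-zeroˡ (f (punchIn j k)))

b2q-∧ : ∀ a b → b2q (a ∧ b) ≡ b2q a * b2q b
b2q-∧ true  b = sym (*-identityˡ (b2q b))
b2q-∧ false b = sym (*-zeroˡ (b2q b))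

b2q-== : ∀ {n} (i j : Fin n) → b2q (i == j) ≡ δ i j
b2q-== i j with i ≟ᶠ j
... | yes _ = refl
... | no  _ = refl

sumF-indicator : ∀ {n} (i : Fin n) → sumF (λ j → b2q (i == j)) ≡ 1ℚ
sumF-indicator i = begin
  sumF (λ j → b2q (i == j))   ≡⟨ sumF-cong (λ j → trans (b2q-== i j) (trans (δ-sym i j) (sym (*-identityʳ (δ j i))))) ⟩
  sumF (λ j → δ j i * 1ℚ)     ≡⟨ sumF-δ i (λ _ → 1ℚ) ⟩
  1ℚ                          ∎

sumF-marginal : ∀ {m n} (f g : Fin m → Fin n) (u : Fin n) →
  sumF (λ k → b2q (f k == u)) ≡ sumF (λ w → sumF (λ k → b2q (f k == u) * b2q (g k == w)))
sumF-marginal f g u = begin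
  sumF (λ k → b2q (f k == u))
    ≡⟨ sumF-cong (λ k → trans (sym (*-identityʳ _)) (cong (b2q (f k == u) *_) (sym (sumF-indicator (g k))))) ⟩
  sumF (λ k → b2q (f k == u) * sumF (λ w → b2q (g k == w)))
    ≡⟨ sumF-cong (λ k → *-distribˡ-sumF (b2q (f k == u)) (λ w → b2q (g k == w))) ⟩
  sumF (λ k → sumF (λ w → b2q (f k == u) * b2q (g k == w)))
    ≡⟨ sumF-comm (λ k w → b2q (f k == u) * b2q (g k == w)) ⟩
  sumF (λ w → sumF (λ k → b2q (f k == u) * b2q (g k == w))) ∎

b2q-does-≟-true : ∀ b → b2q (does (b Bool.≟ true)) ≡ b2q b
b2q-does-≟-true true  = refl
b2q-does-≟-true false = refl

offDiagonal : ∀ {n} → Fin n → Fin n → ℚ → ℚ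
offDiagonal i j v = if i == j then 0ℚ else v

offDiagonal-sym : ∀ {n} (i j : Fin n) v → offDiagonal i j v ≡ offDiagonal j i v
offDiagonal-sym i j v = cong (λ b → if b then 0ℚ else v) (==-sym i j)

sumF-offDiagonal : ∀ {n} (i : Fin (suc n)) (f : Fin (suc n) → ℚ) →
                   sumF (λ j → offDiagonal i j (f j)) ≡ sumF (λ k → f (punchIn i k))
sumF-offDiagonal i f = begin
  sumF (λ j → offDiagonal i j (f j))
    ≡⟨ sumF-remove i (λ j → offDiagonal i j (f j)) ⟩
  offDiagonal i i (f i) + sumF (λ k → offDiagonal i (punchIn i k) (f (punchIn i k)))
    ≡⟨ cong₂ _+_ diagonal (sumF-cong offDiagonal-punchIn) ⟩
  0ℚ + sumF (λ k → f (punchIn i k))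
    ≡⟨ +-identityˡ _ ⟩
  sumF (λ k → f (punchIn i k)) ∎
  where
  diagonal : offDiagonal i i (f i) ≡ 0ℚ
  diagonal rewrite dec-true (i ≟ᶠ i) refl = refl
  offDiagonal-punchIn : ∀ k → offDiagonal i (punchIn i k) (f (punchIn i k)) ≡ f (punchIn i k)
  offDiagonal-punchIn k rewrite dec-false (i ≟ᶠ punchIn i k) (punchInᵢ≢i i k ∘ sym) = refl

-- Both sides sum A over the ordered pairs of distinct indices.
sumF-distinctPairs : ∀ {n} (A : Fin (suc n) → Fin (suc n) → ℚ) →
  sumF (λ i → sumF (λ k → A i (punchIn i k))) ≡ sumF (λ j → sumF (λ k → A (punchIn j k) j))
sumF-distinctPairs A = begin
  sumF (λ i → sumF (λ k → A i (punchIn i k)))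
    ≡⟨ sumF-cong (λ i → sumF-offDiagonal i (A i)) ⟨
  sumF (λ i → sumF (λ j → offDiagonal i j (A i j)))
    ≡⟨ sumF-comm (λ i j → offDiagonal i j (A i j)) ⟩
  sumF (λ j → sumF (λ i → offDiagonal i j (A i j)))
    ≡⟨ sumF-cong (λ j → sumF-cong (λ i → offDiagonal-sym i j (A i j))) ⟩
  sumF (λ j → sumF (λ i → offDiagonal j i (A i j)))
    ≡⟨ sumF-cong (λ j → sumF-offDiagonal j (λ i → A i j)) ⟩
  sumF (λ j → sumF (λ k → A (punchIn j k) j)) ∎

-- Determinants

sgn-+ : ∀ a b → sgn (a ℕ.+ b) ≡ sgn a * sgn b
sgn-+ zero    b = sym (*-identityˡ (sgn b))
sgn-+ (suc a) b = trans (cong -_ (sgn-+ a b)) (neg-distribˡ-* (sgn a) (sgn b))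

minor : ∀ {n} → Mat (suc n) → Fin (suc n) → Fin (suc n) → Mat n
minor M i j a b = M (punchIn i a) (punchIn j b)

det-cong : ∀ {n} {M N : Mat n} → (∀ i j → M i j ≡ N i j) → det M ≡ det N
det-cong {zero}  M≗N = refl
det-cong {suc n} M≗N = sumF-cong (λ j →
  cong₂ (λ a d → sgn (toℕ j) * (a * d)) (M≗N zero j) (det-cong (λ a b → M≗N (suc a) (punchIn j b))))

det-expand-column₀ : ∀ {n} (M : Mat (suc n)) →
  det M ≡ sumF (λ i → sgn (toℕ i) * (M i zero * det (λ a b → M (punchIn i a) (suc b))))
det-expand-column₀ {zero}  M = refl
det-expand-column₀ {suc n} M = cong (sgn 0 * (M zero zero * det (λ a b → M (suc a) (suc b))) +_) (begin
  sumF (λ j → - sgn (toℕ j) * (M zero (suc j) * det (minor M zero (suc j))))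
    ≡⟨ sumF-cong (λ j → cong (λ d → - sgn (toℕ j) * (M zero (suc j) * d))
                             (det-expand-column₀ (minor M zero (suc j)))) ⟩
  sumF (λ j → - sgn (toℕ j) * (M zero (suc j) * sumF (λ i → sgn (toℕ i) * (M (suc i) zero * X i j))))
    ≡⟨ sumF-cong (λ j → *-distribˡ-sumF² (- sgn (toℕ j)) (M zero (suc j))
                                         (λ i → sgn (toℕ i) * (M (suc i) zero * X i j))) ⟩
  sumF (λ j → sumF (λ i → - sgn (toℕ j) * (M zero (suc j) * (sgn (toℕ i) * (M (suc i) zero * X i j)))))
    ≡⟨ sumF-comm (λ j i → - sgn (toℕ j) * (M zero (suc j) * (sgn (toℕ i) * (M (suc i) zero * X i j)))) ⟩
  sumF (λ i → sumF (λ j → - sgn (toℕ j) * (M zero (suc j) * (sgn (toℕ i) * (M (suc i) zero * X i j)))))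
    ≡⟨ sumF-cong (λ i → sumF-cong (λ j → solve 5
         (λ sj a si b x → (:- sj) :* (a :* (si :* (b :* x))) := (:- si) :* (b :* (sj :* (a :* x))))
         refl (sgn (toℕ j)) (M zero (suc j)) (sgn (toℕ i)) (M (suc i) zero) (X i j))) ⟩
  sumF (λ i → sumF (λ j → - sgn (toℕ i) * (M (suc i) zero * (sgn (toℕ j) * (M zero (suc j) * X i j)))))
    ≡⟨ sumF-cong (λ i → *-distribˡ-sumF² (- sgn (toℕ i)) (M (suc i) zero)
                                         (λ j → sgn (toℕ j) * (M zero (suc j) * X i j))) ⟨
  sumF (λ i → - sgn (toℕ i) * (M (suc i) zero * sumF (λ j → sgn (toℕ j) * (M zero (suc j) * X i j)))) ∎)
  where
  X : Fin (suc n) → Fin (suc n) → ℚ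
  X i j = det (λ a b → M (suc (punchIn i a)) (suc (punchIn j b)))

det-transpose : ∀ {n} (M : Mat n) → det (transpose M) ≡ det M
det-transpose {zero}  M = refl
det-transpose {suc n} M = trans
  (sumF-cong (λ i → cong (λ d → sgn (toℕ i) * (M i zero * d))
                         (det-transpose (λ a b → M (punchIn i a) (suc b)))))
  (sym (det-expand-column₀ M))

-- A total punchOut: the value of punchOut′ i i is junk.
punchOut′ : ∀ {n} → Fin (suc (suc n)) → Fin (suc (suc n)) → Fin (suc n)
punchOut′         zero    zero    = zero
punchOut′         zero    (suc j) = j
punchOut′         (suc i) zero    = zero
punchOut′ {zero}  (suc i) (suc j) = zero
punchOut′ {suc n} (suc i) (suc j) = suc (punchOut′ i j)

punchOut′-punchIn : ∀ {n} (i : Fin (suc (suc n))) (k : Fin (suc n)) → punchOut′ i (punchIn i k) ≡ k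
punchOut′-punchIn         zero    k       = refl
punchOut′-punchIn         (suc i) zero    = refl
punchOut′-punchIn {suc n} (suc i) (suc k) = cong suc (punchOut′-punchIn i k)

punchIn-punchIn-swap : ∀ {n} (j : Fin (suc (suc n))) (k : Fin (suc n)) (b : Fin n) →
  punchIn (punchIn j k) (punchIn (punchOut′ (punchIn j k) j) b) ≡ punchIn j (punchIn k b)
punchIn-punchIn-swap         zero    k       b       = refl
punchIn-punchIn-swap         (suc j) zero    b       = refl
punchIn-punchIn-swap {suc n} (suc j) (suc k) zero    = refl
punchIn-punchIn-swap {suc n} (suc j) (suc k) (suc b) = cong suc (punchIn-punchIn-swap j k b)

sgn-punchIn-swap : ∀ {n} (j : Fin (suc (suc n))) (k : Fin (suc n)) →
  sgn (toℕ (punchIn j k)) * sgn (toℕ (punchOut′ (punchIn j k) j)) ≡ - (sgn (toℕ j) * sgn (toℕ k))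
sgn-punchIn-swap zero k =
  solve 1 (λ s → (:- s) :* con 1ℚ := :- (con 1ℚ :* s)) refl (sgn (toℕ k))
sgn-punchIn-swap (suc j) zero =
  solve 1 (λ s → con 1ℚ :* s := :- ((:- s) :* con 1ℚ)) refl (sgn (toℕ j))
sgn-punchIn-swap {suc n} (suc j) (suc k) = begin
  - a * - b          ≡⟨ solve 2 (λ a b → (:- a) :* (:- b) := a :* b) refl a b ⟩
  a * b              ≡⟨ sgn-punchIn-swap j k ⟩
  - (c * d)          ≡⟨ solve 2 (λ c d → :- (c :* d) := :- ((:- c) :* (:- d))) refl c d ⟩
  - (- c * - d)      ∎
  where
  a = sgn (toℕ (punchIn j k))
  b = sgn (toℕ (punchOut′ (punchIn j k) j))
  c = sgn (toℕ j)
  d = sgn (toℕ k)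

rowExpansion : ∀ {n} → Mat (suc n) → Fin (suc n) → (Fin (suc n) → ℚ) → ℚ
rowExpansion M l v = sumF (λ j → sgn (toℕ l ℕ.+ toℕ j) * (v j * det (minor M l j)))

-- Expand along row 0 and then along row l of each minor; the resulting sum over pairs of
-- distinct columns is reindexed so that it becomes the expansion along row (suc l) followed by row 0.
det-rowExpansion : ∀ {n} (l : Fin (suc n)) (M : Mat (suc n)) → det M ≡ rowExpansion M l (M l)
det-rowExpansion zero M = refl
det-rowExpansion {suc n} (suc l) M = begin
  det M
    ≡⟨ sumF-cong (λ j → cong (λ d → sgn (toℕ j) * (x j * d)) (det-rowExpansion l (minor M zero j))) ⟩
  sumF (λ j → sgn (toℕ j) * (x j * sumF (λ k → sgn (toℕ l ℕ.+ toℕ k) * (y (punchIn j k) * F j k))))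
    ≡⟨ sumF-cong (λ j → *-distribˡ-sumF² (sgn (toℕ j)) (x j)
                           (λ k → sgn (toℕ l ℕ.+ toℕ k) * (y (punchIn j k) * F j k))) ⟩
  sumF (λ j → sumF (λ k → sgn (toℕ j) * (x j * (sgn (toℕ l ℕ.+ toℕ k) * (y (punchIn j k) * F j k)))))
    ≡⟨ sumF-cong (λ j → sumF-cong (λ k → A-punchIn j k)) ⟨
  sumF (λ j → sumF (λ k → A j (punchIn j k)))
    ≡⟨ sumF-distinctPairs A ⟩
  sumF (λ c → sumF (λ k → A (punchIn c k) c))
    ≡⟨ sumF-cong (λ c → sumF-cong (λ k → A-swap c k)) ⟩
  sumF (λ c → sumF (λ k → sgn (suc (toℕ l ℕ.+ toℕ c)) * (y c * (sgn (toℕ k) * (x (punchIn c k) * F c k)))))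
    ≡⟨ sumF-cong (λ c → *-distribˡ-sumF² (sgn (suc (toℕ l ℕ.+ toℕ c))) (y c)
                           (λ k → sgn (toℕ k) * (x (punchIn c k) * F c k))) ⟨
  rowExpansion M (suc l) (M (suc l)) ∎
  where
  x y : Fin (suc (suc n)) → ℚ
  x = M zero
  y = M (suc l)
  F : Fin (suc (suc n)) → Fin (suc n) → ℚ
  F j k = det (λ a b → M (suc (punchIn l a)) (punchIn j (punchIn k b)))
  A : Fin (suc (suc n)) → Fin (suc (suc n)) → ℚ
  A j c = sgn (toℕ j) * (x j * (sgn (toℕ l ℕ.+ toℕ (punchOut′ j c)) * (y c * F j (punchOut′ j c))))
  A-punchIn : ∀ j k → A j (punchIn j k)
                    ≡ sgn (toℕ j) * (x j * (sgn (toℕ l ℕ.+ toℕ k) * (y (punchIn j k) * F j k)))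
  A-punchIn j k rewrite punchOut′-punchIn j k = refl
  A-swap : ∀ c k → A (punchIn c k) c
                 ≡ sgn (suc (toℕ l ℕ.+ toℕ c)) * (y c * (sgn (toℕ k) * (x (punchIn c k) * F c k)))
  A-swap c k = begin
    sj * (x j * (sgn (toℕ l ℕ.+ toℕ p) * (y c * F j p)))
      ≡⟨ cong₂ (λ s f → sj * (x j * (s * (y c * f)))) (sgn-+ (toℕ l) (toℕ p))
               (det-cong (λ a b → cong (M (suc (punchIn l a))) (punchIn-punchIn-swap c k b))) ⟩
    sj * (x j * ((sl * sp) * (y c * F c k)))
      ≡⟨ solve 6 (λ sj xj sl sp yc f → sj :* (xj :* ((sl :* sp) :* (yc :* f)))
                                      := sl :* (sj :* sp) :* (yc :* (xj :* f)))
               refl sj (x j) sl sp (y c) (F c k) ⟩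
    sl * (sj * sp) * (y c * (x j * F c k))
      ≡⟨ cong (λ s → sl * s * (y c * (x j * F c k))) (sgn-punchIn-swap c k) ⟩
    sl * - (sc * sk) * (y c * (x j * F c k))
      ≡⟨ solve 6 (λ sl sc sk yc xj f → sl :* (:- (sc :* sk)) :* (yc :* (xj :* f))
                                      := (:- (sl :* sc)) :* (yc :* (sk :* (xj :* f))))
               refl sl sc sk (y c) (x j) (F c k) ⟩
    - (sl * sc) * (y c * (sk * (x j * F c k)))
      ≡⟨ cong (λ s → - s * (y c * (sk * (x j * F c k)))) (sgn-+ (toℕ l) (toℕ c)) ⟨
    sgn (suc (toℕ l ℕ.+ toℕ c)) * (y c * (sk * (x j * F c k))) ∎
    where
    j = punchIn c k
    p = punchOut′ j c
    sj = sgn (toℕ j)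
    sp = sgn (toℕ p)
    sl = sgn (toℕ l)
    sc = sgn (toℕ c)
    sk = sgn (toℕ k)

-- The solver's left-hand side is det M unfolded along the first row.
det₂ : (M : Mat 2) → det M ≡ M zero zero * M (suc zero) (suc zero) - M zero (suc zero) * M (suc zero) zero
det₂ M = solve 4 (λ a b c d → con 1ℚ :* (a :* (con 1ℚ :* (d :* con 1ℚ) :+ con 0ℚ))
                              :+ (con (- 1ℚ) :* (b :* (con 1ℚ :* (c :* con 1ℚ) :+ con 0ℚ)) :+ con 0ℚ)
                            := a :* d :- b :* c)
                 refl (M zero zero) (M zero (suc zero)) (M (suc zero) zero) (M (suc zero) (suc zero))

outside₂ : ∀ {m} (r t : Fin (3 ℕ.+ m)) → Σ (Fin (3 ℕ.+ m)) (λ q → q ≢ r × q ≢ t)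
outside₂ zero          zero          = suc zero , (λ ()) , (λ ())
outside₂ zero          (suc zero)    = suc (suc zero) , (λ ()) , (λ ())
outside₂ zero          (suc (suc t)) = suc zero , (λ ()) , (λ ())
outside₂ (suc zero)    zero          = suc (suc zero) , (λ ()) , (λ ())
outside₂ (suc zero)    (suc t)       = zero , (λ ()) , (λ ())
outside₂ (suc (suc r)) zero          = suc zero , (λ ()) , (λ ())
outside₂ (suc (suc r)) (suc t)       = zero , (λ ()) , (λ ())

det₂-equalRows : (M : Mat 2) → (∀ j → M zero j ≡ M (suc zero) j) → det M ≡ 0ℚ
det₂-equalRows M M₀≗M₁ = begin
  det M                                     ≡⟨ det₂ M ⟩
  M zero zero * d - M zero (suc zero) * c   ≡⟨ cong₂ (λ a b → a * d - b * c) (M₀≗M₁ zero) (M₀≗M₁ (suc zero)) ⟩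
  c * d - d * c                             ≡⟨ solve 2 (λ c d → c :* d :- d :* c := con 0ℚ) refl c d ⟩
  0ℚ                                        ∎
  where
  c = M (suc zero) zero
  d = M (suc zero) (suc zero)

-- Expanding along a third row q leaves minors which still have two equal rows.
det-equalRows : ∀ {n} (M : Mat n) (r t : Fin n) → r ≢ t → (∀ j → M r j ≡ M t j) → det M ≡ 0ℚ
det-equalRows {1} M zero zero r≢t _ = contradiction refl r≢t
det-equalRows {2} M zero zero r≢t _ = contradiction refl r≢t
det-equalRows {2} M (suc zero) (suc zero) r≢t _ = contradiction refl r≢t
det-equalRows {2} M zero (suc zero) _ Mr≗Mt = det₂-equalRows M Mr≗Mt
det-equalRows {2} M (suc zero) zero _ Mr≗Mt = det₂-equalRows M (sym ∘ Mr≗Mt)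
det-equalRows {suc (suc (suc m))} M r t r≢t Mr≗Mt = begin
  det M
    ≡⟨ det-rowExpansion q M ⟩
  rowExpansion M q (M q)
    ≡⟨ sumF-zero _ (λ j → term-zero j (det-equalRows (minor M q j) r′ t′ r′≢t′ (minor-equalRows j))) ⟩
  0ℚ ∎
  where
  q = proj₁ (outside₂ r t)
  q≢r = proj₁ (proj₂ (outside₂ r t))
  q≢t = proj₂ (proj₂ (outside₂ r t))
  r′ t′ : Fin (suc (suc m))
  r′ = punchOut q≢r
  t′ = punchOut q≢t
  r′≢t′ : r′ ≢ t′
  r′≢t′ r′≡t′ = r≢t (trans (sym (punchIn-punchOut q≢r)) (trans (cong (punchIn q) r′≡t′) (punchIn-punchOut q≢t)))
  minor-equalRows : ∀ j k → minor M q j r′ k ≡ minor M q j t′ k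
  minor-equalRows j k = trans (cong (λ i → M i (punchIn j k)) (punchIn-punchOut q≢r))
    (trans (Mr≗Mt (punchIn j k)) (cong (λ i → M i (punchIn j k)) (sym (punchIn-punchOut q≢t))))
  term-zero : ∀ j → det (minor M q j) ≡ 0ℚ → sgn (toℕ q ℕ.+ toℕ j) * (M q j * det (minor M q j)) ≡ 0ℚ
  term-zero j minor≡0 rewrite minor≡0 =
    solve 2 (λ s a → s :* (a :* con 0ℚ) := con 0ℚ) refl (sgn (toℕ q ℕ.+ toℕ j)) (M q j)

replaceRow : ∀ {n} → Mat n → Fin n → (Fin n → ℚ) → Mat n
replaceRow M l v i j = if i == l then v j else M i j

det-replaceRow : ∀ {n} (M : Mat (suc n)) l v → det (replaceRow M l v) ≡ rowExpansion M l v
det-replaceRow M l v = trans (det-rowExpansion l (replaceRow M l v)) (sumF-cong (λ j →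
  cong₂ (λ a d → sgn (toℕ l ℕ.+ toℕ j) * (a * d)) (row-l j) (det-cong (λ a b → row-punchIn a (punchIn j b)))))
  where
  row-l : ∀ j → replaceRow M l v l j ≡ v j
  row-l j rewrite dec-true (l ≟ᶠ l) refl = refl
  row-punchIn : ∀ a b → replaceRow M l v (punchIn l a) b ≡ M (punchIn l a) b
  row-punchIn a b rewrite dec-false (punchIn l a ≟ᶠ l) (punchInᵢ≢i l a) = refl

-- For i ≢ l this is the determinant of M with row l replaced by row i.
rowExpansion-row : ∀ {n} (M : Mat (suc n)) l i → rowExpansion M l (M i) ≡ δ i l * det M
rowExpansion-row M l i with i ≟ᶠ l
... | yes refl = trans (sym (det-rowExpansion i M)) (sym (*-identityˡ (det M)))
... | no  i≢l  = begin
  rowExpansion M l (M i)        ≡⟨ det-replaceRow M l (M i) ⟨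
  det (replaceRow M l (M i))    ≡⟨ det-equalRows (replaceRow M l (M i)) l i (i≢l ∘ sym) row-l≗row-i ⟩
  0ℚ                            ≡⟨ *-zeroˡ (det M) ⟨
  0ℚ * det M                    ∎
  where
  row-l≗row-i : ∀ j → replaceRow M l (M i) l j ≡ replaceRow M l (M i) i j
  row-l≗row-i j rewrite dec-true (l ≟ᶠ l) refl | dec-false (i ≟ᶠ l) i≢l = refl

rowExpansion-subtract : ∀ {n m} (M : Mat (suc n)) l v (c : Fin m → ℚ) (w : Fin m → Fin (suc n) → ℚ) →
  rowExpansion M l (λ j → v j - sumF (λ t → c t * w t j))
  ≡ rowExpansion M l v - sumF (λ t → c t * rowExpansion M l (w t))
rowExpansion-subtract M l v c w = begin
  sumF (λ j → s j * ((v j - x j) * d j))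
    ≡⟨ sumF-cong (λ j → solve 4 (λ s v x d → s :* ((v :- x) :* d) := s :* (v :* d) :- x :* (s :* d))
                                refl (s j) (v j) (x j) (d j)) ⟩
  sumF (λ j → s j * (v j * d j) - x j * (s j * d j))
    ≡⟨ sumF-+ (λ j → s j * (v j * d j)) (λ j → - (x j * (s j * d j))) ⟩
  rowExpansion M l v + sumF (λ j → - (x j * (s j * d j)))
    ≡⟨ cong (rowExpansion M l v +_) (sumF-neg (λ j → x j * (s j * d j))) ⟩
  rowExpansion M l v - sumF (λ j → x j * (s j * d j))
    ≡⟨ cong (λ z → rowExpansion M l v - z) (sumF-cong (λ j → begin
         x j * (s j * d j)
           ≡⟨ *-distribʳ-sumF (s j * d j) (λ t → c t * w t j) ⟩
         sumF (λ t → c t * w t j * (s j * d j))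
           ≡⟨ sumF-cong (λ t → solve 4 (λ c w s d → c :* w :* (s :* d) := c :* (s :* (w :* d)))
                                       refl (c t) (w t j) (s j) (d j)) ⟩
         sumF (λ t → c t * (s j * (w t j * d j))) ∎)) ⟩
  rowExpansion M l v - sumF (λ j → sumF (λ t → c t * (s j * (w t j * d j))))
    ≡⟨ cong (λ z → rowExpansion M l v - z) (sumF-comm (λ j t → c t * (s j * (w t j * d j)))) ⟩
  rowExpansion M l v - sumF (λ t → sumF (λ j → c t * (s j * (w t j * d j))))
    ≡⟨ cong (λ z → rowExpansion M l v - z)
            (sumF-cong (λ t → *-distribˡ-sumF (c t) (λ j → s j * (w t j * d j)))) ⟨
  rowExpansion M l v - sumF (λ t → c t * rowExpansion M l (w t)) ∎
  where
  s d x : Fin _ → ℚ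
  s j = sgn (toℕ l ℕ.+ toℕ j)
  d j = det (minor M l j)
  x j = sumF (λ t → c t * w t j)

det-subtractRows₀ : ∀ {n} (M N : Mat (suc n)) (c : Fin n → ℚ) →
  (∀ j → N zero j ≡ M zero j - sumF (λ t → c t * M (suc t) j)) →
  (∀ i j → N (suc i) j ≡ M (suc i) j) → det N ≡ det M
det-subtractRows₀ M N c N₀≡ Nₛ≡ = begin
  det N
    ≡⟨ sumF-cong (λ j → cong₂ (λ a d → sgn (toℕ j) * (a * d)) (N₀≡ j) (det-cong (λ a b → Nₛ≡ a (punchIn j b)))) ⟩
  rowExpansion M zero (λ j → M zero j - sumF (λ t → c t * M (suc t) j))
    ≡⟨ rowExpansion-subtract M zero (M zero) c (λ t → M (suc t)) ⟩
  det M - sumF (λ t → c t * rowExpansion M zero (M (suc t)))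
    ≡⟨ cong (λ z → det M - z) (sumF-zero _ (λ t → trans (cong (c t *_) (rowExpansion-row M zero (suc t)))
                                                 (solve 2 (λ c d → c :* (con 0ℚ :* d) := con 0ℚ) refl (c t) (det M)))) ⟩
  det M - 0ℚ
    ≡⟨ solve 1 (λ d → d :- con 0ℚ := d) refl (det M) ⟩
  det M ∎

adjugate-mul : ∀ {n} (K : Mat n) l w′ → sumF (λ w → adjugate K l w * K w w′) ≡ δ l w′ * det K
adjugate-mul {suc n} K l w′ = begin
  sumF (λ w → adjugate K l w * K w w′)
    ≡⟨ sumF-cong (λ w → trans (cong (λ d → sgn (toℕ l ℕ.+ toℕ w) * d * K w w′)
                                    (det-transpose (minor (transpose K) l w)))
                              (*-comm-middle (sgn (toℕ l ℕ.+ toℕ w)) _ (K w w′))) ⟩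
  rowExpansion (transpose K) l (transpose K w′)
    ≡⟨ rowExpansion-row (transpose K) l w′ ⟩
  δ w′ l * det (transpose K)
    ≡⟨ cong₂ _*_ (δ-sym w′ l) (det-transpose K) ⟩
  δ l w′ * det K ∎
  where
  *-comm-middle : ∀ s d k → s * d * k ≡ s * (k * d)
  *-comm-middle = solve 3 (λ s d k → s :* d :* k := s :* (k :* d)) refl

-- Block matrices

punchIn-↑ˡ : ∀ {n} p (j : Fin (suc n)) (v : Fin n) → punchIn (j ↑ˡ p) (v ↑ˡ p) ≡ punchIn j v ↑ˡ p
punchIn-↑ˡ p zero    v       = refl
punchIn-↑ˡ p (suc j) zero    = refl
punchIn-↑ˡ p (suc j) (suc v) = cong suc (punchIn-↑ˡ p j v)

punchIn-↑ʳ : ∀ {n} p (j : Fin (suc n)) (c : Fin p) → punchIn (j ↑ˡ p) (n ↑ʳ c) ≡ suc n ↑ʳ c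
punchIn-↑ʳ         p zero    c = refl
punchIn-↑ʳ {suc n} p (suc j) c = cong suc (punchIn-↑ʳ p j c)

lowerRight : ∀ n {p} → Mat (n ℕ.+ p) → Mat p
lowerRight n N c d = N (n ↑ʳ c) (n ↑ʳ d)

-- With the upper right block B = Y D, this is the Schur complement A − Y C of D.
schurComplement : ∀ n {p} → Mat (n ℕ.+ p) → (Fin n → Fin p → ℚ) → Mat n
schurComplement n {p} N Y u v = N (u ↑ˡ p) (v ↑ˡ p) - sumF (λ t → Y u t * N (n ↑ʳ t) (v ↑ˡ p))

UpperRightFactors : ∀ n {p} → Mat (n ℕ.+ p) → (Fin n → Fin p → ℚ) → Set
UpperRightFactors n {p} N Y = ∀ u c → N (u ↑ˡ p) (n ↑ʳ c) ≡ sumF (λ t → Y u t * N (n ↑ʳ t) (n ↑ʳ c))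

-- Subtracting Y₀ times the lower rows clears the right part of row 0; expanding along row 0
-- then leaves minors of the same shape.
det-schurComplement : ∀ n {p} (N : Mat (n ℕ.+ p)) (Y : Fin n → Fin p → ℚ) → UpperRightFactors n N Y →
  det N ≡ det (schurComplement n N Y) * det (lowerRight n N)
det-schurComplement zero    N Y _ = sym (*-identityˡ (det N))
det-schurComplement (suc n) {p} N Y B≡YD = begin
  det N
    ≡⟨ det-subtractRows₀ N N′ (zeroExtendˡ n (Y zero)) N′₀≡ (λ _ _ → refl) ⟨
  det N′
    ≡⟨ sumF-↑ (suc n) (λ j → sgn (toℕ j) * (N′ zero j * det (minor N′ zero j))) ⟩
  sumF (λ j → sgn (toℕ (j ↑ˡ p)) * (N′ zero (j ↑ˡ p) * det (minor N′ zero (j ↑ˡ p))))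
    + sumF (λ d → sgn (toℕ (suc n ↑ʳ d)) * (N′ zero (suc n ↑ʳ d) * det (minor N′ zero (suc n ↑ʳ d))))
    ≡⟨ cong₂ _+_ (sumF-cong left) (sumF-zero _ right) ⟩
  sumF (λ j → sgn (toℕ j) * (S zero j * (det (minor S zero j) * det D))) + 0ℚ
    ≡⟨ +-identityʳ _ ⟩
  sumF (λ j → sgn (toℕ j) * (S zero j * (det (minor S zero j) * det D)))
    ≡⟨ sumF-cong (λ j → solve 4 (λ s a b d → s :* (a :* (b :* d)) := s :* (a :* b) :* d)
                                refl (sgn (toℕ j)) (S zero j) (det (minor S zero j)) (det D)) ⟩
  sumF (λ j → sgn (toℕ j) * (S zero j * det (minor S zero j)) * det D)
    ≡⟨ *-distribʳ-sumF (det D) (λ j → sgn (toℕ j) * (S zero j * det (minor S zero j))) ⟨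
  det S * det D ∎
  where
  S = schurComplement (suc n) N Y
  D = lowerRight (suc n) N
  N′ : Mat (suc n ℕ.+ p)
  N′ zero    j = N zero j - sumF (λ t → Y zero t * N (suc n ↑ʳ t) j)
  N′ (suc i) j = N (suc i) j
  N′₀≡ : ∀ j → N′ zero j ≡ N zero j - sumF (λ t → zeroExtendˡ n (Y zero) t * N (suc t) j)
  N′₀≡ j = cong (λ z → N zero j - z) (sym (sumF-zeroExtendˡ n (Y zero) (λ t → N (suc t) j)))
  right : ∀ d → sgn (toℕ (suc n ↑ʳ d)) * (N′ zero (suc n ↑ʳ d) * det (minor N′ zero (suc n ↑ʳ d))) ≡ 0ℚ
  right d rewrite B≡YD zero d =
    solve 3 (λ s x m → s :* ((x :- x) :* m) := con 0ℚ) refl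
            (sgn (toℕ (suc n ↑ʳ d))) (sumF (λ t → Y zero t * N (suc n ↑ʳ t) (suc n ↑ʳ d)))
            (det (minor N′ zero (suc n ↑ʳ d)))
  minor-schur : ∀ j → det (minor N′ zero (j ↑ˡ p)) ≡ det (minor S zero j) * det D
  minor-schur j = begin
    det (minor N′ zero (j ↑ˡ p))
      ≡⟨ det-schurComplement n (minor N′ zero (j ↑ˡ p)) (λ u → Y (suc u)) factors ⟩
    det (schurComplement n (minor N′ zero (j ↑ˡ p)) (λ u → Y (suc u))) * det (lowerRight n (minor N′ zero (j ↑ˡ p)))
      ≡⟨ cong₂ _*_ (det-cong (λ u v → cong₂ (λ a b → N (suc u ↑ˡ p) a - sumF (λ t → Y (suc u) t * N (suc n ↑ʳ t) b))
                                             (punchIn-↑ˡ p j v) (punchIn-↑ˡ p j v)))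
                   (det-cong (λ c d → cong (N (suc n ↑ʳ c)) (punchIn-↑ʳ p j d))) ⟩
    det (minor S zero j) * det D ∎
    where
    factors : UpperRightFactors n (minor N′ zero (j ↑ˡ p)) (λ u → Y (suc u))
    factors u c rewrite punchIn-↑ʳ p j c = B≡YD (suc u) c
  left : ∀ j → sgn (toℕ (j ↑ˡ p)) * (N′ zero (j ↑ˡ p) * det (minor N′ zero (j ↑ˡ p)))
             ≡ sgn (toℕ j) * (S zero j * (det (minor S zero j) * det D))
  left j = cong₂ (λ s d → sgn s * (S zero j * d)) (toℕ-↑ˡ j p) (minor-schur j)

upperLeft : ∀ n {p} → Mat (n ℕ.+ p) → Mat n
upperLeft n {p} N u v = N (u ↑ˡ p) (v ↑ˡ p)

det-blockTriangular : ∀ n {p} (N : Mat (n ℕ.+ p)) → (∀ u c → N (u ↑ˡ p) (n ↑ʳ c) ≡ 0ℚ) →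
  det N ≡ det (upperLeft n N) * det (lowerRight n N)
det-blockTriangular n {p} N B≡0 = begin
  det N
    ≡⟨ det-schurComplement n N (λ _ _ → 0ℚ) (λ u c → trans (B≡0 u c) (sym (sumF-0* (λ t → N (n ↑ʳ t) (n ↑ʳ c))))) ⟩
  det (schurComplement n N (λ _ _ → 0ℚ)) * det (lowerRight n N)
    ≡⟨ cong (_* det (lowerRight n N)) (det-cong (λ u v →
         trans (cong (λ z → N (u ↑ˡ p) (v ↑ˡ p) - z) (sumF-0* (λ t → N (n ↑ʳ t) (v ↑ˡ p)))) (+-identityʳ (N (u ↑ˡ p) (v ↑ˡ p))))) ⟩
  det (upperLeft n N) * det (lowerRight n N) ∎
  where
  sumF-0* : ∀ (g : Fin p → ℚ) → sumF (λ t → 0ℚ * g t) ≡ 0ℚ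
  sumF-0* g = sumF-zero _ (λ t → *-zeroˡ (g t))

BlockDiagonal : ∀ {n} → Mat n → ∀ m → Mat (m ℕ.* n) → Set
BlockDiagonal {n} K m N =
  ∀ k w k′ w′ → N (combine {m} {n} k w) (combine k′ w′) ≡ δ k k′ * K w w′

det-blockDiagonal : ∀ {n} (K : Mat n) m (N : Mat (m ℕ.* n)) → BlockDiagonal K m N → det N ≡ pow (det K) m
det-blockDiagonal K zero    N _ = refl
det-blockDiagonal {n} K (suc m) N N-diag = begin
  det N
    ≡⟨ det-blockTriangular n N upperRight≡0 ⟩
  det (upperLeft n N) * det (lowerRight n N)
    ≡⟨ cong₂ _*_ (det-cong (λ u v → trans (N-diag zero u zero v) (*-identityˡ (K u v))))
                 (det-blockDiagonal K m (lowerRight n N) (λ k w k′ w′ → N-diag (suc k) w (suc k′) w′)) ⟩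
  det K * pow (det K) m ∎
  where
  upperRight≡0 : ∀ u c → N (u ↑ˡ m ℕ.* n) (n ↑ʳ c) ≡ 0ℚ
  upperRight≡0 u c = trans (cong (λ c′ → N (u ↑ˡ m ℕ.* n) (n ↑ʳ c′)) (sym (combine-remQuot {m} n c)))
                           (trans (N-diag zero u (suc (proj₁ (remQuot {m} n c))) (proj₂ (remQuot {m} n c)))
                                  (*-zeroˡ (K u (proj₂ (remQuot {m} n c)))))

onesᵀInverse : ∀ {n} (K : Mat n) → det K ≢ 0ℚ → Fin n → ℚ
onesᵀInverse K det≢0 w = sumF (λ l → adjugate K l w) * inv (det K) det≢0

onesᵀInverse-mul : ∀ {n} (K : Mat n) (det≢0 : det K ≢ 0ℚ) w′ →
                   sumF (λ w → onesᵀInverse K det≢0 w * K w w′) ≡ 1ℚ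
onesᵀInverse-mul K det≢0 w′ = begin
  sumF (λ w → sumF (λ l → adjugate K l w) * d⁻¹ * K w w′)
    ≡⟨ sumF-cong (λ w → solve 3 (λ s i k → s :* i :* k := i :* (s :* k)) refl
                                (sumF (λ l → adjugate K l w)) d⁻¹ (K w w′)) ⟩
  sumF (λ w → d⁻¹ * (sumF (λ l → adjugate K l w) * K w w′))
    ≡⟨ *-distribˡ-sumF d⁻¹ (λ w → sumF (λ l → adjugate K l w) * K w w′) ⟨
  d⁻¹ * sumF (λ w → sumF (λ l → adjugate K l w) * K w w′)
    ≡⟨ cong (d⁻¹ *_) (sumF-cong (λ w → *-distribʳ-sumF (K w w′) (λ l → adjugate K l w))) ⟩
  d⁻¹ * sumF (λ w → sumF (λ l → adjugate K l w * K w w′))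
    ≡⟨ cong (d⁻¹ *_) (sumF-comm (λ w l → adjugate K l w * K w w′)) ⟩
  d⁻¹ * sumF (λ l → sumF (λ w → adjugate K l w * K w w′))
    ≡⟨ cong (d⁻¹ *_) (trans (sumF-cong (λ l → adjugate-mul K l w′)) (sumF-δ w′ (λ _ → det K))) ⟩
  d⁻¹ * det K
    ≡⟨ *-inverseˡ (det K) {{≢-nonZero det≢0}} ⟩
  1ℚ ∎
  where
  d⁻¹ = inv (det K) det≢0

chi≡sumF-onesᵀInverse : ∀ {n} (M : Mat n) y (det≢0 : det (shift y M) ≢ 0ℚ) →
                        chi M y ≡ sumF (onesᵀInverse (shift y M) det≢0)
chi≡sumF-onesᵀInverse M y det≢0 with det (shift y M) ≟ 0ℚ
... | yes det≡0 = contradiction det≡0 det≢0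
... | no  _     = trans (cong (_* inv (det (shift y M)) det≢0) (sumF-comm (λ l w → adjugate (shift y M) l w)))
                        (*-distribʳ-sumF (inv (det (shift y M)) det≢0) (λ w → sumF (λ l → adjugate (shift y M) l w)))

-- Block shape of λI − Q for a corona: a copy block k meets vertex u of the base only through
-- the constants β k u (upper right) and γ k u (lower left).
record CoronaShaped {n₁ m n₂} (N : Mat (n₁ ℕ.+ m ℕ.* n₂)) (P : Mat n₁)
                    (β γ : Fin m → Fin n₁ → ℚ) (K : Mat n₂) : Set where
  field
    upperLeft≡  : ∀ u v → upperLeft n₁ N u v ≡ P u v
    upperRight≡ : ∀ u k w → N (u ↑ˡ m ℕ.* n₂) (n₁ ↑ʳ combine k w) ≡ β k u
    lowerLeft≡  : ∀ k w v → N (n₁ ↑ʳ combine k w) (v ↑ˡ m ℕ.* n₂) ≡ γ k v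
    lowerRight≡ : BlockDiagonal K m (lowerRight n₁ N)

module _ {n₁ m n₂} {N : Mat (n₁ ℕ.+ m ℕ.* n₂)} {P : Mat n₁} {β γ : Fin m → Fin n₁ → ℚ} {K : Mat n₂}
         (shaped : CoronaShaped N P β γ K) (det≢0 : det K ≢ 0ℚ) where

  open CoronaShaped shaped

  private
    cb : Fin m → Fin n₂ → Fin (m ℕ.* n₂)
    cb = combine

    z : Fin n₂ → ℚ
    z = onesᵀInverse K det≢0

    Y : Fin n₁ → Fin (m ℕ.* n₂) → ℚ
    Y u t = β (proj₁ (remQuot {m} n₂ t)) u * z (proj₂ (remQuot {m} n₂ t))

    Y-combine : ∀ u k w → Y u (cb k w) ≡ β k u * z w
    Y-combine u k w = cong (λ kw → β (proj₁ kw) u * z (proj₂ kw)) (remQuot-combine k w)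

    YD-block : ∀ u k′ w′ k → sumF (λ w → Y u (cb k w) * N (n₁ ↑ʳ cb k w) (n₁ ↑ʳ cb k′ w′))
                            ≡ δ k k′ * β k u
    YD-block u k′ w′ k = begin
      sumF (λ w → Y u (cb k w) * N (n₁ ↑ʳ cb k w) (n₁ ↑ʳ cb k′ w′))
        ≡⟨ sumF-cong (λ w → cong₂ _*_ (Y-combine u k w) (lowerRight≡ k w k′ w′)) ⟩
      sumF (λ w → β k u * z w * (δ k k′ * K w w′))
        ≡⟨ sumF-cong (λ w → solve 4 (λ b z d k → b :* z :* (d :* k) := d :* b :* (z :* k))
                                    refl (β k u) (z w) (δ k k′) (K w w′)) ⟩
      sumF (λ w → δ k k′ * β k u * (z w * K w w′))
        ≡⟨ *-distribˡ-sumF (δ k k′ * β k u) (λ w → z w * K w w′) ⟨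
      δ k k′ * β k u * sumF (λ w → z w * K w w′)
        ≡⟨ cong (δ k k′ * β k u *_) (onesᵀInverse-mul K det≢0 w′) ⟩
      δ k k′ * β k u * 1ℚ
        ≡⟨ *-identityʳ _ ⟩
      δ k k′ * β k u ∎

    upperRight-factors : UpperRightFactors n₁ N Y
    upperRight-factors u c = begin
      N (u ↑ˡ m ℕ.* n₂) (n₁ ↑ʳ c)
        ≡⟨ cong (λ c′ → N (u ↑ˡ m ℕ.* n₂) (n₁ ↑ʳ c′)) (sym c≡) ⟩
      N (u ↑ˡ m ℕ.* n₂) (n₁ ↑ʳ cb k′ w′)
        ≡⟨ upperRight≡ u k′ w′ ⟩
      β k′ u
        ≡⟨ sumF-δ k′ (λ k → β k u) ⟨
      sumF (λ k → δ k k′ * β k u)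
        ≡⟨ sumF-cong (YD-block u k′ w′) ⟨
      sumF (λ k → sumF (λ w → Y u (cb k w) * N (n₁ ↑ʳ cb k w) (n₁ ↑ʳ cb k′ w′)))
        ≡⟨ sumF-combine m n₂ (λ t → Y u t * N (n₁ ↑ʳ t) (n₁ ↑ʳ cb k′ w′)) ⟨
      sumF (λ t → Y u t * N (n₁ ↑ʳ t) (n₁ ↑ʳ cb k′ w′))
        ≡⟨ cong (λ c′ → sumF (λ t → Y u t * N (n₁ ↑ʳ t) (n₁ ↑ʳ c′))) c≡ ⟩
      sumF (λ t → Y u t * N (n₁ ↑ʳ t) (n₁ ↑ʳ c)) ∎
      where
      k′ = proj₁ (remQuot {m} n₂ c)
      w′ = proj₂ (remQuot {m} n₂ c)
      c≡ : combine k′ w′ ≡ c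
      c≡ = combine-remQuot {m} n₂ c

    schurComplement≡ : ∀ u v → schurComplement n₁ N Y u v
                               ≡ P u v - sumF (onesᵀInverse K det≢0) * sumF (λ k → β k u * γ k v)
    schurComplement≡ u v = cong₂ _-_ (upperLeft≡ u v) (begin
      sumF (λ t → Y u t * N (n₁ ↑ʳ t) (v ↑ˡ m ℕ.* n₂))
        ≡⟨ sumF-combine m n₂ (λ t → Y u t * N (n₁ ↑ʳ t) (v ↑ˡ m ℕ.* n₂)) ⟩
      sumF (λ k → sumF (λ w → Y u (cb k w) * N (n₁ ↑ʳ cb k w) (v ↑ˡ m ℕ.* n₂)))
        ≡⟨ sumF-cong (λ k → sumF-cong (λ w → cong₂ _*_ (Y-combine u k w) (lowerLeft≡ k w v))) ⟩
      sumF (λ k → sumF (λ w → β k u * z w * γ k v))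
        ≡⟨ sumF-cong (λ k → sumF-cong (λ w → solve 3 (λ b z g → b :* z :* g := z :* (b :* g))
                                                    refl (β k u) (z w) (γ k v))) ⟩
      sumF (λ k → sumF (λ w → z w * (β k u * γ k v)))
        ≡⟨ sumF-cong (λ k → *-distribʳ-sumF (β k u * γ k v) z) ⟨
      sumF (λ k → sumF z * (β k u * γ k v))
        ≡⟨ *-distribˡ-sumF (sumF z) (λ k → β k u * γ k v) ⟨
      sumF z * sumF (λ k → β k u * γ k v) ∎)

  det-coronaShaped : det N ≡ pow (det K) m
                             * det (λ u v → P u v - sumF (onesᵀInverse K det≢0) * sumF (λ k → β k u * γ k v))
  det-coronaShaped = begin
    det N
      ≡⟨ det-schurComplement n₁ N Y upperRight-factors ⟩
    det (schurComplement n₁ N Y) * det (lowerRight n₁ N)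
      ≡⟨ cong₂ _*_ (det-cong schurComplement≡) (det-blockDiagonal K m (lowerRight n₁ N) lowerRight≡) ⟩
    det (λ u v → P u v - sumF z * sumF (λ k → β k u * γ k v)) * pow (det K) m
      ≡⟨ *-comm _ (pow (det K) m) ⟩
    pow (det K) m * det (λ u v → P u v - sumF z * sumF (λ k → β k u * γ k v)) ∎

-- Coronas

↑ˡ≢↑ʳ : ∀ {n p} (u : Fin n) (c : Fin p) → u ↑ˡ p ≢ n ↑ʳ c
↑ˡ≢↑ʳ {n} {p} u c eq with () ← trans (sym (splitAt-↑ˡ n u p)) (trans (cong (splitAt n) eq) (splitAt-↑ʳ n p c))

label-↑ˡ : ∀ n₁ m n₂ (u : Fin n₁) → label n₁ m n₂ (u ↑ˡ m ℕ.* n₂) ≡ inj₁ u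
label-↑ˡ n₁ m n₂ u rewrite splitAt-↑ˡ n₁ u (m ℕ.* n₂) = refl

label-↑ʳ : ∀ n₁ m n₂ (k : Fin m) (w : Fin n₂) → label n₁ m n₂ (n₁ ↑ʳ combine k w) ≡ inj₂ (k , w)
label-↑ʳ n₁ m n₂ k w rewrite splitAt-↑ʳ n₁ (m ℕ.* n₂) (combine k w) | remQuot-combine {m} {n₂} k w = refl

outDegree : ∀ {n} → (Fin n → Fin n → Bool) → Fin n → ℚ
outDegree a i = sumF (λ j → b2q (a i j))

cong₃ : ∀ {A B C D : Set} (f : A → B → C → D) {a a′ b b′ c c′} → a ≡ a′ → b ≡ b′ → c ≡ c′ → f a b c ≡ f a′ b′ c′
cong₃ f refl refl refl = refl

shift-QM-offDiagonal : ∀ {n} {x : ℚ} {a : Fin n → Fin n → Bool} {i j} → i ≢ j → shift x (QM a) i j ≡ - b2q (a i j)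
shift-QM-offDiagonal {x = x} {a} {i} {j} i≢j rewrite δ-≢ i≢j =
  solve 3 (λ x o b → x :* con 0ℚ :- (con 0ℚ :* o :+ b) := :- b) refl x (outDegree a i) (b2q (a i j))

module Corona {n₁ n₂ m} (D₁ : Digraph n₁) (D₂ : Digraph n₂) (into outof : Fin m → Fin n₁ → Bool) where

  arcs : Fin (n₁ ℕ.+ m ℕ.* n₂) → Fin (n₁ ℕ.+ m ℕ.* n₂) → Bool
  arcs a b = coronaAdj D₁ D₂ into outof (label n₁ m n₂ a) (label n₁ m n₂ b)

  intoCount : Fin n₁ → ℚ
  intoCount u = sumF (λ k → b2q (into k u))

  private
    p = m ℕ.* n₂

    cb : Fin m → Fin n₂ → Fin p
    cb = combine

    arcs-labels : ∀ {a b s t} → label n₁ m n₂ a ≡ s → label n₁ m n₂ b ≡ t →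
                  arcs a b ≡ coronaAdj D₁ D₂ into outof s t
    arcs-labels = cong₂ (coronaAdj D₁ D₂ into outof)

    outDegree-split : ∀ a → outDegree arcs a
                            ≡ sumF (λ v → b2q (arcs a (v ↑ˡ p))) + sumF (λ k → sumF (λ w → b2q (arcs a (n₁ ↑ʳ cb k w))))
    outDegree-split a = trans (sumF-↑ n₁ (λ j → b2q (arcs a j)))
      (cong (sumF (λ v → b2q (arcs a (v ↑ˡ p))) +_) (sumF-combine m n₂ (λ t → b2q (arcs a (n₁ ↑ʳ t)))))

  outDegree-base : ∀ u → outDegree arcs (u ↑ˡ p) ≡ outDegree (adj D₁) u + ℕtoℚ n₂ * intoCount u
  outDegree-base u = begin
    outDegree arcs (u ↑ˡ p)
      ≡⟨ outDegree-split (u ↑ˡ p) ⟩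
    sumF (λ v → b2q (arcs (u ↑ˡ p) (v ↑ˡ p))) + sumF (λ k → sumF (λ w → b2q (arcs (u ↑ˡ p) (n₁ ↑ʳ cb k w))))
      ≡⟨ cong₂ _+_ (sumF-cong (λ v → cong b2q (arcs-labels (label-↑ˡ n₁ m n₂ u) (label-↑ˡ n₁ m n₂ v))))
                   (sumF-cong (λ k → trans (sumF-cong (λ w → cong b2q (arcs-labels (label-↑ˡ n₁ m n₂ u) (label-↑ʳ n₁ m n₂ k w))))
                                           (sumF-const n₂ (b2q (into k u))))) ⟩
    outDegree (adj D₁) u + sumF (λ k → ℕtoℚ n₂ * b2q (into k u))
      ≡⟨ cong (outDegree (adj D₁) u +_) (*-distribˡ-sumF (ℕtoℚ n₂) (λ k → b2q (into k u))) ⟨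
    outDegree (adj D₁) u + ℕtoℚ n₂ * intoCount u ∎

  outDegree-copy : ∀ {r} → (∀ k → sumF (λ v → b2q (outof k v)) ≡ r) →
                   ∀ k w → outDegree arcs (n₁ ↑ʳ cb k w) ≡ r + outDegree (adj D₂) w
  outDegree-copy {r} outof≡r k w = begin
    outDegree arcs (n₁ ↑ʳ cb k w)
      ≡⟨ outDegree-split (n₁ ↑ʳ cb k w) ⟩
    sumF (λ v → b2q (arcs (n₁ ↑ʳ cb k w) (v ↑ˡ p)))
      + sumF (λ k′ → sumF (λ w′ → b2q (arcs (n₁ ↑ʳ cb k w) (n₁ ↑ʳ cb k′ w′))))
      ≡⟨ cong₂ _+_ (trans (sumF-cong (λ v → cong b2q (arcs-labels (label-↑ʳ n₁ m n₂ k w) (label-↑ˡ n₁ m n₂ v))))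
                          (outof≡r k))
                   (sumF-cong copy-row) ⟩
    r + sumF (λ k′ → δ k′ k * outDegree (adj D₂) w)
      ≡⟨ cong (r +_) (sumF-δ k (λ _ → outDegree (adj D₂) w)) ⟩
    r + outDegree (adj D₂) w ∎
    where
    copy-row : ∀ k′ → sumF (λ w′ → b2q (arcs (n₁ ↑ʳ cb k w) (n₁ ↑ʳ cb k′ w′))) ≡ δ k′ k * outDegree (adj D₂) w
    copy-row k′ = begin
      sumF (λ w′ → b2q (arcs (n₁ ↑ʳ cb k w) (n₁ ↑ʳ cb k′ w′)))
        ≡⟨ sumF-cong (λ w′ → trans (cong b2q (arcs-labels (label-↑ʳ n₁ m n₂ k w) (label-↑ʳ n₁ m n₂ k′ w′)))
                                   (b2q-∧ (k == k′) (adj D₂ w w′))) ⟩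
      sumF (λ w′ → b2q (k == k′) * b2q (adj D₂ w w′))
        ≡⟨ *-distribˡ-sumF (b2q (k == k′)) (λ w′ → b2q (adj D₂ w w′)) ⟨
      b2q (k == k′) * outDegree (adj D₂) w
        ≡⟨ cong (_* outDegree (adj D₂) w) (trans (b2q-== k k′) (δ-sym k k′)) ⟩
      δ k′ k * outDegree (adj D₂) w ∎

  baseMatrix : ℚ → Mat n₁
  baseMatrix x = shift x (Q[ D₁ ] ⊕ (ℕtoℚ n₂ · diag intoCount))

  shift-QM-base : ∀ x u v → shift x (QM arcs) (u ↑ˡ p) (v ↑ˡ p) ≡ baseMatrix x u v
  shift-QM-base x u v = begin
    x * δ (u ↑ˡ p) (v ↑ˡ p) - (δ (u ↑ˡ p) (v ↑ˡ p) * outDegree arcs (u ↑ˡ p) + b2q (arcs (u ↑ˡ p) (v ↑ˡ p)))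
      ≡⟨ cong₃ (λ d o a → x * d - (d * o + b2q a)) (δ-injective (_↑ˡ p) (↑ˡ-injective p _ _) u v)
               (outDegree-base u) (arcs-labels (label-↑ˡ n₁ m n₂ u) (label-↑ˡ n₁ m n₂ v)) ⟩
    x * δ u v - (δ u v * (outDegree (adj D₁) u + ℕtoℚ n₂ * intoCount u) + b2q (adj D₁ u v))
      ≡⟨ solve 6 (λ x d o n i a → x :* d :- (d :* (o :+ n :* i) :+ a) := x :* d :- ((d :* o :+ a) :+ n :* (d :* i)))
                 refl x (δ u v) (outDegree (adj D₁) u) (ℕtoℚ n₂) (intoCount u) (b2q (adj D₁ u v)) ⟩
    baseMatrix x u v ∎

  -- Each copy vertex has r extra out-arcs into D₁, which shifts the diagonal of its block by r.
  shift-QM-copies : ∀ x {r} → (∀ k → sumF (λ v → b2q (outof k v)) ≡ r) →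
                    BlockDiagonal (shift (x - r) Q[ D₂ ]) m (lowerRight n₁ (shift x (QM arcs)))
  shift-QM-copies x {r} outof≡r k w k′ w′ with k ≟ᶠ k′
  ... | no k≢k′ = begin
    shift x (QM arcs) (n₁ ↑ʳ cb k w) (n₁ ↑ʳ cb k′ w′)
      ≡⟨ shift-QM-offDiagonal {x = x} {a = arcs} (k≢k′ ∘ combine-injectiveˡ k w k′ w′ ∘ ↑ʳ-injective n₁ _ _) ⟩
    - b2q (arcs (n₁ ↑ʳ cb k w) (n₁ ↑ʳ cb k′ w′))
      ≡⟨ cong (-_ ∘ b2q) (trans (arcs-labels (label-↑ʳ n₁ m n₂ k w) (label-↑ʳ n₁ m n₂ k′ w′))
                                (cong (_∧ adj D₂ w w′) (dec-false (k ≟ᶠ k′) k≢k′))) ⟩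
    0ℚ
      ≡⟨ *-zeroˡ (shift (x - r) Q[ D₂ ] w w′) ⟨
    0ℚ * shift (x - r) Q[ D₂ ] w w′ ∎
  ... | yes refl = begin
    x * δ (n₁ ↑ʳ cb k w) (n₁ ↑ʳ cb k w′)
      - (δ (n₁ ↑ʳ cb k w) (n₁ ↑ʳ cb k w′) * outDegree arcs (n₁ ↑ʳ cb k w) + b2q (arcs (n₁ ↑ʳ cb k w) (n₁ ↑ʳ cb k w′)))
      ≡⟨ cong₃ (λ d o a → x * d - (d * o + b2q a))
               (δ-injective (λ w → n₁ ↑ʳ cb k w) (combine-injectiveʳ k _ k _ ∘ ↑ʳ-injective n₁ _ _) w w′)
               (outDegree-copy outof≡r k w)
               (trans (arcs-labels (label-↑ʳ n₁ m n₂ k w) (label-↑ʳ n₁ m n₂ k w′))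
                      (cong (_∧ adj D₂ w w′) (dec-true (k ≟ᶠ k) refl))) ⟩
    x * δ w w′ - (δ w w′ * (r + outDegree (adj D₂) w) + b2q (adj D₂ w w′))
      ≡⟨ solve 5 (λ x d r o a → x :* d :- (d :* (r :+ o) :+ a) := (x :- r) :* d :- (d :* o :+ a))
                 refl x (δ w w′) r (outDegree (adj D₂) w) (b2q (adj D₂ w w′)) ⟩
    shift (x - r) Q[ D₂ ] w w′
      ≡⟨ *-identityˡ _ ⟨
    1ℚ * shift (x - r) Q[ D₂ ] w w′ ∎

  coronaShaped : ∀ x r → (∀ k → sumF (λ v → b2q (outof k v)) ≡ r) →
    CoronaShaped (shift x (QM arcs)) (baseMatrix x) (λ k u → - b2q (into k u)) (λ k v → - b2q (outof k v))
                 (shift (x - r) Q[ D₂ ])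
  coronaShaped x r outof≡r = record
    { upperLeft≡  = shift-QM-base x
    ; upperRight≡ = λ u k w → trans (shift-QM-offDiagonal {x = x} {a = arcs} (↑ˡ≢↑ʳ u (cb k w)))
                                    (cong (-_ ∘ b2q) (arcs-labels (label-↑ˡ n₁ m n₂ u) (label-↑ʳ n₁ m n₂ k w)))
    ; lowerLeft≡  = λ k w v → trans (shift-QM-offDiagonal {x = x} {a = arcs} (↑ˡ≢↑ʳ v (cb k w) ∘ sym))
                                    (cong (-_ ∘ b2q) (arcs-labels (label-↑ʳ n₁ m n₂ k w) (label-↑ˡ n₁ m n₂ v)))
    ; lowerRight≡ = shift-QM-copies x outof≡r
    }

  charPoly-corona : ∀ x r (d : Fin n₁ → ℚ) (S : Mat n₁) →
    (∀ k → sumF (λ v → b2q (outof k v)) ≡ r) →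
    (∀ u → intoCount u ≡ d u) →
    (∀ u v → sumF (λ k → b2q (into k u) * b2q (outof k v)) ≡ S u v) →
    charPoly Q[ D₂ ] (x - r) ≢ 0ℚ →
    charPoly (QM arcs) x
    ≡ pow (charPoly Q[ D₂ ] (x - r)) m * det (shift x (Q[ D₁ ] ⊕ (ℕtoℚ n₂ · diag d)) ⊖ (chi Q[ D₂ ] (x - r) · S))
  charPoly-corona x r d S outof≡r intoCount≗d pairs≗S det≢0 =
    trans (det-coronaShaped (coronaShaped x r outof≡r) det≢0)
          (cong (pow (charPoly Q[ D₂ ] (x - r)) m *_) (det-cong entry))
    where
    entry : ∀ u v → baseMatrix x u v - sumF (onesᵀInverse (shift (x - r) Q[ D₂ ]) det≢0)
                                        * sumF (λ k → - b2q (into k u) * - b2q (outof k v))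
                    ≡ (shift x (Q[ D₁ ] ⊕ (ℕtoℚ n₂ · diag d)) ⊖ (chi Q[ D₂ ] (x - r) · S)) u v
    entry u v = cong₂ _-_
      (cong (λ i → x * δ u v - (Q[ D₁ ] u v + ℕtoℚ n₂ * (δ u v * i))) (intoCount≗d u))
      (cong₂ _*_ (sym (chi≡sumF-onesᵀInverse Q[ D₂ ] (x - r) det≢0))
                 (trans (sumF-cong (λ k → solve 2 (λ a b → (:- a) :* (:- b) := a :* b) refl
                                                  (b2q (into k u)) (b2q (outof k v))))
                        (pairs≗S u v)))

-- Enumerations of arcs and edges

module Enumeration {n m} {P : Fin n → Fin n → Set} (P-irrelevant : ∀ {u v} (p q : P u v) → p ≡ q)
                   (P? : ∀ u v → Dec (P u v)) (enum : Fin m ↔ Σ (Fin n × Fin n) (λ uv → P (proj₁ uv) (proj₂ uv)))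
                   where

  source target : Fin m → Fin n
  source k = proj₁ (proj₁ (Inverse.to enum k))
  target k = proj₂ (proj₁ (Inverse.to enum k))

  count-pairs : ∀ u v → sumF (λ k → b2q (source k == u) * b2q (target k == v)) ≡ b2q (does (P? u v))
  count-pairs u v with P? u v
  ... | no ¬Puv = sumF-zero _ term-zero
    where
    term-zero : ∀ k → b2q (source k == u) * b2q (target k == v) ≡ 0ℚ
    term-zero k with source k ≟ᶠ u | target k ≟ᶠ v
    ... | yes refl | yes refl = contradiction (proj₂ (Inverse.to enum k)) ¬Puv
    ... | yes _    | no  _    = refl
    ... | no  _    | yes _    = refl
    ... | no  _    | no  _    = refl
  ... | yes Puv = trans (sumF-cong term-δ) (sumF-δ k₀ (λ _ → 1ℚ))
    where
    k₀ = Inverse.from enum ((u , v) , Puv)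
    to-k₀ : Inverse.to enum k₀ ≡ ((u , v) , Puv)
    to-k₀ = Inverse.strictlyInverseˡ enum ((u , v) , Puv)
    term-δ : ∀ k → b2q (source k == u) * b2q (target k == v) ≡ δ k k₀ * 1ℚ
    term-δ k with k ≟ᶠ k₀
    ... | yes refl rewrite to-k₀ | dec-true (u ≟ᶠ u) refl | dec-true (v ≟ᶠ v) refl = refl
    ... | no k≢k₀ with source k ≟ᶠ u | target k ≟ᶠ v
    ...   | yes refl | yes refl = contradiction
              (trans (sym (Inverse.strictlyInverseʳ enum k)) (cong (Inverse.from enum ∘ ((u , v) ,_))
                                                                  (P-irrelevant (proj₂ (Inverse.to enum k)) Puv)))
              k≢k₀
    ...   | yes _    | no  _    = refl
    ...   | no  _    | yes _    = refl
    ...   | no  _    | no  _    = refl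

  count-sources : ∀ u → sumF (λ k → b2q (source k == u)) ≡ sumF (λ v → b2q (does (P? u v)))
  count-sources u = trans (sumF-marginal source target u) (sumF-cong (count-pairs u))

  count-targets : ∀ v → sumF (λ k → b2q (target k == v)) ≡ sumF (λ u → b2q (does (P? u v)))
  count-targets v = trans (sumF-marginal target source v) (sumF-cong (λ u →
    trans (sumF-cong (λ k → *-comm (b2q (target k == v)) (b2q (source k == u)))) (count-pairs u v)))

module ArcEnumeration {n m} (D : Digraph n) (arcs : Fin m ↔ Arc D) where

  open Enumeration {P = λ u v → adj D u v ≡ true} (Decidable⇒UIP.≡-irrelevant Bool._≟_)
                   (λ u v → adj D u v Bool.≟ true) arcs public

  count-arcs : ∀ u v → sumF (λ k → b2q (source k == u) * b2q (target k == v)) ≡ b2q (adj D u v)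
  count-arcs u v = trans (count-pairs u v) (b2q-does-≟-true (adj D u v))

  count-tails : ∀ u → sumF (λ k → b2q (source k == u)) ≡ sumF (λ v → b2q (adj D u v))
  count-tails u = trans (count-sources u) (sumF-cong (λ v → b2q-does-≟-true (adj D u v)))

  count-heads : ∀ v → sumF (λ k → b2q (target k == v)) ≡ sumF (λ u → b2q (adj D u v))
  count-heads v = trans (count-targets v) (sumF-cong (λ u → b2q-does-≟-true (adj D u v)))

module EdgeEnumeration {n m} (D : Digraph n) (edges : Fin m ↔ Edge D) where

  private
    IsEdge : Fin n → Fin n → Set
    IsEdge u v = (u < v) × (uadj D u v ≡ true)

    IsEdge-irrelevant : ∀ {u v} (e e′ : IsEdge u v) → e ≡ e′
    IsEdge-irrelevant (u<v , e) (u<v′ , e′) = cong₂ _,_ (<-irrelevant u<v u<v′) (Decidable⇒UIP.≡-irrelevant Bool._≟_ e e′)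

    IsEdge? : ∀ u v → Dec (IsEdge u v)
    IsEdge? u v = (u <? v) ×-dec (uadj D u v Bool.≟ true)

  open Enumeration IsEdge-irrelevant IsEdge? edges

  ends : Fin m → Fin n → Bool
  ends k z = (source k == z) ∨ (target k == z)

  private
    isEdge : Fin n → Fin n → ℚ
    isEdge u v = b2q (does (IsEdge? u v))

    isEdge≡ : ∀ u v → isEdge u v ≡ b2q (does (u <? v)) * b2q (uadj D u v)
    isEdge≡ u v = trans (b2q-∧ (does (u <? v)) (does (uadj D u v Bool.≟ true)))
                        (cong (b2q (does (u <? v)) *_) (b2q-does-≟-true (uadj D u v)))

    -- Each edge {u, v} of U(D) is enumerated once, in the orientation u < v.
    isEdge-sym : ∀ u v → isEdge u v + isEdge v u ≡ b2q (uadj D u v)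
    isEdge-sym u v rewrite isEdge≡ u v | isEdge≡ v u | Bool.∨-comm (adj D v u) (adj D u v) with <-cmp u v
    ... | tri< u<v _ _ rewrite dec-true (u <? v) u<v | dec-false (v <? u) (<-asym u<v) =
      solve 1 (λ a → con 1ℚ :* a :+ con 0ℚ :* a := a) refl (b2q (uadj D u v))
    ... | tri> _ _ v<u rewrite dec-false (u <? v) (<-asym v<u) | dec-true (v <? u) v<u =
      solve 1 (λ a → con 0ℚ :* a :+ con 1ℚ :* a := a) refl (b2q (uadj D u v))
    ... | tri≈ u≮u refl _ rewrite dec-false (u <? u) u≮u | loopless D u = refl

    b2q-ends : ∀ k z → b2q (ends k z) ≡ b2q (source k == z) + b2q (target k == z)
    b2q-ends k z with source k ≟ᶠ z | target k ≟ᶠ z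
    ... | yes refl | yes t≡s = contradiction (sym t≡s) (<⇒≢ (proj₁ (proj₂ (Inverse.to edges k))))
    ... | yes _    | no  _   = refl
    ... | no  _    | yes _   = refl
    ... | no  _    | no  _   = refl

    b2q-==-square : ∀ (a u v : Fin n) → b2q (a == u) * b2q (a == v) ≡ δ u v * b2q (a == u)
    b2q-==-square a u v with a ≟ᶠ u
    ... | yes refl = trans (*-identityˡ (b2q (a == v))) (trans (b2q-== a v) (sym (*-identityʳ (δ a v))))
    ... | no  _    = trans (*-zeroˡ (b2q (a == v))) (sym (*-zeroʳ (δ u v)))

  count-ends : ∀ k → sumF (λ z → b2q (ends k z)) ≡ ℕtoℚ 2
  count-ends k = trans (sumF-cong (b2q-ends k))
                       (trans (sumF-+ (λ z → b2q (source k == z)) (λ z → b2q (target k == z)))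
                              (cong₂ _+_ (sumF-indicator (source k)) (sumF-indicator (target k))))

  count-incidences : ∀ u → sumF (λ k → b2q (source k == u) + b2q (target k == u)) ≡ sumF (λ w → b2q (uadj D u w))
  count-incidences u = begin
    sumF (λ k → b2q (source k == u) + b2q (target k == u))
      ≡⟨ sumF-+ (λ k → b2q (source k == u)) (λ k → b2q (target k == u)) ⟩
    sumF (λ k → b2q (source k == u)) + sumF (λ k → b2q (target k == u))
      ≡⟨ cong₂ _+_ (count-sources u) (count-targets u) ⟩
    sumF (λ w → isEdge u w) + sumF (λ w → isEdge w u)
      ≡⟨ sumF-+ (λ w → isEdge u w) (λ w → isEdge w u) ⟨
    sumF (λ w → isEdge u w + isEdge w u)
      ≡⟨ sumF-cong (isEdge-sym u) ⟩
    sumF (λ w → b2q (uadj D u w)) ∎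

  count-incident-edges : ∀ u → sumF (λ k → b2q (ends k u)) ≡ sumF (λ w → b2q (uadj D u w))
  count-incident-edges u = trans (sumF-cong (λ k → b2q-ends k u)) (count-incidences u)

  count-common-edges : ∀ u v → sumF (λ k → b2q (ends k u) * b2q (ends k v)) ≡ QU[ D ] u v
  count-common-edges u v = begin
    sumF (λ k → b2q (ends k u) * b2q (ends k v))
      ≡⟨ sumF-cong expand ⟩
    sumF (λ k → δ u v * (su k + tu k) + (su k * tv k + sv k * tu k))
      ≡⟨ sumF-+ (λ k → δ u v * (su k + tu k)) (λ k → su k * tv k + sv k * tu k) ⟩
    sumF (λ k → δ u v * (su k + tu k)) + sumF (λ k → su k * tv k + sv k * tu k)
      ≡⟨ cong₂ _+_ (trans (sym (*-distribˡ-sumF (δ u v) (λ k → su k + tu k))) (cong (δ u v *_) (count-incidences u)))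
                   (trans (sumF-+ (λ k → su k * tv k) (λ k → sv k * tu k)) (cong₂ _+_ (count-pairs u v) (count-pairs v u))) ⟩
    δ u v * sumF (λ w → b2q (uadj D u w)) + (isEdge u v + isEdge v u)
      ≡⟨ cong (δ u v * sumF (λ w → b2q (uadj D u w)) +_) (isEdge-sym u v) ⟩
    QU[ D ] u v ∎
    where
    su tu sv tv : Fin m → ℚ
    su k = b2q (source k == u)
    tu k = b2q (target k == u)
    sv k = b2q (source k == v)
    tv k = b2q (target k == v)
    expand : ∀ k → b2q (ends k u) * b2q (ends k v) ≡ δ u v * (su k + tu k) + (su k * tv k + sv k * tu k)
    expand k = begin
      b2q (ends k u) * b2q (ends k v)
        ≡⟨ cong₂ _*_ (b2q-ends k u) (b2q-ends k v) ⟩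
      (su k + tu k) * (sv k + tv k)
        ≡⟨ solve 4 (λ a b c d → (a :+ b) :* (c :+ d) := a :* c :+ b :* d :+ (a :* d :+ c :* b)) refl
                   (su k) (tu k) (sv k) (tv k) ⟩
      su k * sv k + tu k * tv k + (su k * tv k + sv k * tu k)
        ≡⟨ cong₂ (λ a b → a + b + (su k * tv k + sv k * tu k))
                 (b2q-==-square (source k) u v) (b2q-==-square (target k) u v) ⟩
      δ u v * su k + δ u v * tu k + (su k * tv k + sv k * tu k)
        ≡⟨ cong (_+ (su k * tv k + sv k * tu k)) (*-distribˡ-+ (δ u v) (su k) (tu k)) ⟨
      δ u v * (su k + tu k) + (su k * tv k + sv k * tu k) ∎

theorem4p11 : (n1 n2 m1 m1' : ℕ) (D1 : Digraph n1) (D2 : Digraph n2)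
              (arcs : Fin m1 ↔ Arc D1) (edges : Fin m1' ↔ Edge D1) (x : ℚ) →
              (charPoly Q[ D2 ] (x - 1ℚ) ≢ 0ℚ →
                 charPoly (QM (fwdCorona D1 D2 (Inverse.to arcs))) x
                 ≡ pow (charPoly Q[ D2 ] (x - 1ℚ)) m1
                   * det (shift x (Q[ D1 ] ⊕ (ℕtoℚ n2 · Dout[ D1 ]))
                          ⊖ (chi Q[ D2 ] (x - 1ℚ) · A[ D1 ])))
              × (charPoly Q[ D2 ] (x - 1ℚ) ≢ 0ℚ →
                 charPoly (QM (bwdCorona D1 D2 (Inverse.to arcs))) x
                 ≡ pow (charPoly Q[ D2 ] (x - 1ℚ)) m1
                   * det (shift x (Q[ D1 ] ⊕ (ℕtoℚ n2 · Din[ D1 ]))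
                          ⊖ (chi Q[ D2 ] (x - 1ℚ) · transpose A[ D1 ])))
              × (charPoly Q[ D2 ] (x - ℕtoℚ 2) ≢ 0ℚ →
                 charPoly (QM (symCorona D1 D2 (Inverse.to edges))) x
                 ≡ pow (charPoly Q[ D2 ] (x - ℕtoℚ 2)) m1'
                   * det (shift x (Q[ D1 ] ⊕ (ℕtoℚ n2 · Ddeg[U D1 ]))
                          ⊖ (chi Q[ D2 ] (x - ℕtoℚ 2) · QU[ D1 ])))
theorem4p11 n1 n2 m1 m1' D1 D2 arcs edges x =
    Corona.charPoly-corona D1 D2 (λ k u → source k == u) (λ k v → target k == v) x 1ℚ _ _
      (sumF-indicator ∘ target) count-tails count-arcs
  , Corona.charPoly-corona D1 D2 (λ k u → target k == u) (λ k v → source k == v) x 1ℚ _ _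
      (sumF-indicator ∘ source) count-heads
      (λ u v → trans (sumF-cong (λ k → *-comm (b2q (target k == u)) (b2q (source k == v)))) (count-arcs v u))
  , Corona.charPoly-corona D1 D2 ends ends x (ℕtoℚ 2) _ _
      count-ends count-incident-edges count-common-edges
  where
  open ArcEnumeration D1 arcs
  open EdgeEnumeration D1 edges
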